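{- For every positive integer $n$, \[ \mathcal{M}^{(3)}(n)=\Bigl\lfloor \frac{n^2-18n+101}{108}\Bigr\rfloor+\begin{cases}1,&\text{if } n\equiv 36 \pmod{54},\\ -1,&\text{if } n\equiv 30 \pmod{54}\text{ or } n\equiv 42\pmod{54},\\ 0,&\text{otherwise.}\end{cases} \]
   Context: For $n\in\mathbb{N}$ let $[n]=\{1,\dots,n\}$. For $a>0$ and integers $1\le s\le t\le n$, consider the coloring of $[n]$ in which $1,\dots,s$ and $t+1,\dots,n$ are red and $s+1,\dots,t$ are blue (written $R^sB^{t-s}R^{n-t}$). Define $\mathcal{M}^{(a)}(n,s,t)$ as the number of ordered pairs $(x,y)\in[n]^2$ such that the triple $T=(x,y,x+\lfloor ay\rfloor)$ lies in $[n]^3$ and either $T\in([s]\cup\{t+1,\dots,n\})^3$ or $T\in\{s+1,\dots,t\}^3$. Define $\mathcal{M}^{(a)}(n)=\min_{1\le s\le t\le n}\mathcal{M}^{(a)}(n,s,t)$. -}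

module Defs where

open import Data.Nat using (ℕ; zero; suc; _+_; _*_; _∸_; _≤ᵇ_; _<ᵇ_; _⊓_)
open import Data.Bool using (Bool; true; false; _∧_; _∨_; if_then_else_)
open import Data.Nat.ListAction using (sum)
open import Data.List using (List; []; _∷_; map; concatMap; foldr; length; filter)
open import Data.List.Base using (upTo)

range : ℕ → ℕ → List ℕ
range a b = map (λ i → a + i) (upTo (suc b ∸ a))

-- membership of k in the red set [s] ∪ {t+1,...,n}  (assuming 1 ≤ k ≤ n)
isRed : ℕ → ℕ → ℕ → Bool
isRed s t k = (k ≤ᵇ s) ∨ (t <ᵇ k)

isBlue : ℕ → ℕ → ℕ → Bool
isBlue s t k = (s <ᵇ k) ∧ (k ≤ᵇ t)

-- indicator that the pair (x,y) gives a monochromatic triple (x, y, x + ⌊a y⌋)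
-- with a = 3, so ⌊3y⌋ = 3 * y; x,y range over [n], and we require x + 3y ≤ n.
good : ℕ → ℕ → ℕ → ℕ → ℕ → Bool
good n s t x y =
  let z = x + 3 * y in
  (z ≤ᵇ n) ∧
  ((isRed s t x ∧ isRed s t y ∧ isRed s t z) ∨
   (isBlue s t x ∧ isBlue s t y ∧ isBlue s t z))

b2n : Bool → ℕ
b2n true = 1
b2n false = 0

M3nst : ℕ → ℕ → ℕ → ℕ
M3nst n s t = sum (concatMap (λ x → map (λ y → b2n (good n s t x y)) (range 1 n)) (range 1 n))

minList : ℕ → List ℕ → ℕ
minList d xs = foldr _⊓_ d xs

allValues : ℕ → List ℕ
allValues n = concatMap (λ s → map (λ t → M3nst n s t) (range s n)) (range 1 n)

-- 𝓜^{(3)}(n) = min over 1 ≤ s ≤ t ≤ n of 𝓜^{(3)}(n,s,t)  (for n ≥ 1; the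
-- default value M3nst n 1 1 is itself among the values, so it does not affect the min)
M3 : ℕ → ℕ
M3 n = minList (M3nst n 1 1) (allValues n)

{-# OPTIONS --safe #-}
-- Let τ m be the number of pairs x, y ≥ 1 with x + 3y ≤ m.  For the colouring RˢBᑫRʳ and c = q - 3s ≥ 0, the
-- monochromatic triples inside the first red, the blue and (unless r > 3s + 3) across the last red block number
-- τ s + τ c + τ r, and 4s + r + c = n.  Since 24 τ m + 1 is (2m - 3)², or (2m - 3)² - 8 if 3 ∣ m, Lagrange's
-- identity 18(S² + R² + C²) = (4S + R + C)² + (S - 4R)² + (S - 4C)² + (R - C)² bounds this sum below by
-- (n² - 18n + 101) / 108 up to an error depending on the number of multiples of 3 among s, r, c.  The rounding goes
-- wrong only if (S, R, C) = (2s - 3, 2r - 3, 2c - 3) is nearly proportional to (4, 1, 1), and this is where the classes of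
-- n mod 54 come from.  Colourings with r > 3s + 3 or q < 3s are compared with triples (s, r, c) with 4s + r + c ≥ n,
-- or lose by a wide margin.  Replacing (s, r, c) by (s + 12, r + 3, c + 3) turns an optimum for n into one for n + 54.
module Submission where

open import Defs
open import Data.Bool using (Bool; true; false; T; _∧_; _∨_; if_then_else_)
open import Data.Bool.Properties using (T-∧; T-∨)
open import Data.Empty using (⊥; ⊥-elim)
open import Data.Fin using (Fin; toℕ; fromℕ<)
open import Data.Fin.Properties using (all?; any?; toℕ-fromℕ<)
open import Data.List using (List; []; _∷_; map; concatMap; upTo; applyUpTo)
open import Data.List.Properties using (map-∘; map-upTo)
open import Data.List.Membership.Propositional using (_∈_; find; lose)
open import Data.List.Membership.Propositional.Properties
  using (∈-concatMap⁺; ∈-concatMap⁻; ∈-map⁺; ∈-map⁻; ∈-upTo⁺; ∈-upTo⁻)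
open import Data.List.Relation.Unary.Any using (here; there)
open import Data.Nat.ListAction using (sum)
open import Data.Nat.ListAction.Properties using (sum-++)
open import Data.Product using (∃; _×_; _,_; proj₁; proj₂)
open import Data.Sum as Sum using (_⊎_; inj₁; inj₂)
open import Data.Unit using (tt)
open import Function using (_∘_; Equivalence)
open import Relation.Nullary using (¬_; Dec; yes; no)
open import Relation.Nullary.Decidable using (from-yes; _×-dec_)
open import Relation.Binary.PropositionalEquality

-- Finite sums, and the number of monochromatic triples as a double sum.

module Counting where

  open import Data.Nat using (ℕ; zero; suc; _+_; _*_; _∸_; _≤_; _<_; _≤ᵇ_; _<ᵇ_; z≤n; s≤s; s≤s⁻¹; _≤?_)
  open import Data.Nat.Properties
  open import Data.Nat.Tactic.RingSolver using (solve-∀)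

  -- Under the bound `3 + m` the pairs with `y = 1` number `m`, and lowering `y` by one in the
  -- remaining pairs gives those under the bound `m`.
  τ : ℕ → ℕ
  τ (suc (suc (suc m))) = m + τ m
  τ _ = 0

  Σ< : ℕ → (ℕ → ℕ) → ℕ
  Σ< zero    f = 0
  Σ< (suc n) f = f 0 + Σ< n (f ∘ suc)

  syntax Σ< n (λ i → e) = Σ[ i < n ] e

  Σ-cong : ∀ n {f g} → (∀ i → f i ≡ g i) → Σ< n f ≡ Σ< n g
  Σ-cong zero    h = refl
  Σ-cong (suc n) h = cong₂ _+_ (h 0) (Σ-cong n (h ∘ suc))

  Σ-mono : ∀ n {f g} → (∀ i → i < n → f i ≤ g i) → Σ< n f ≤ Σ< n g
  Σ-mono zero    h = z≤n
  Σ-mono (suc n) h = +-mono-≤ (h 0 (s≤s z≤n)) (Σ-mono n λ i i<n → h (suc i) (s≤s i<n))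

  Σ-zero : ∀ n → Σ[ i < n ] 0 ≡ 0
  Σ-zero zero    = refl
  Σ-zero (suc n) = Σ-zero n

  Σ-distrib-+ : ∀ n f g → Σ[ i < n ] (f i + g i) ≡ Σ< n f + Σ< n g
  Σ-distrib-+ zero    f g = refl
  Σ-distrib-+ (suc n) f g = trans (cong (f 0 + g 0 +_) (Σ-distrib-+ n (f ∘ suc) (g ∘ suc)))
    (interchange (f 0) (g 0) (Σ< n (f ∘ suc)) (Σ< n (g ∘ suc)))
    where
    interchange : ∀ a b c d → a + b + (c + d) ≡ a + c + (b + d)
    interchange = solve-∀

  Σ-swap : ∀ m n (f : ℕ → ℕ → ℕ) → Σ[ i < m ] Σ[ k < n ] f i k ≡ Σ[ k < n ] Σ[ i < m ] f i k
  Σ-swap zero    n f = sym (Σ-zero n)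
  Σ-swap (suc m) n f = trans (cong (Σ< n (f 0) +_) (Σ-swap m n (f ∘ suc)))
    (sym (Σ-distrib-+ n (f 0) (λ k → Σ[ i < m ] f (suc i) k)))

  Σ-split : ∀ m n f → Σ< (m + n) f ≡ Σ< m f + Σ< n (f ∘ (m +_))
  Σ-split zero    n f = refl
  Σ-split (suc m) n f = trans (cong (f 0 +_) (Σ-split m n (f ∘ suc))) (sym (+-assoc (f 0) _ _))

  Σ-split₃ : ∀ s q r f → Σ< (s + q + r) f ≡ Σ< s f + Σ< q (f ∘ (s +_)) + Σ< r (f ∘ (s + q +_))
  Σ-split₃ s q r f = trans (Σ-split (s + q) r f) (cong (_+ Σ< r (f ∘ (s + q +_))) (Σ-split s q f))

  sum-concatMap : ∀ (g : ℕ → List ℕ) xs → sum (concatMap g xs) ≡ sum (map (sum ∘ g) xs)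
  sum-concatMap g []       = refl
  sum-concatMap g (x ∷ xs) = trans (sum-++ (g x) (concatMap g xs)) (cong (sum (g x) +_) (sum-concatMap g xs))

  sum-applyUpTo : ∀ f n → sum (applyUpTo f n) ≡ Σ< n f
  sum-applyUpTo f zero    = refl
  sum-applyUpTo f (suc n) = cong (f 0 +_) (sum-applyUpTo (f ∘ suc) n)

  sum-range : ∀ f n → sum (map f (range 1 n)) ≡ Σ[ i < n ] f (suc i)
  sum-range f n = trans (cong sum (trans (sym (map-∘ (upTo n))) (map-upTo (f ∘ suc) n))) (sum-applyUpTo (f ∘ suc) n)

  weight : ℕ → ℕ → ℕ → ℕ → ℕ → ℕ
  weight n s t x y = b2n (good n s t x y)

  M3nst-Σ : ∀ n s t → M3nst n s t ≡ Σ[ i < n ] Σ[ k < n ] weight n s t (suc i) (suc k)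
  M3nst-Σ n s t = trans (sum-concatMap (λ x → map (weight n s t x) (range 1 n)) (range 1 n))
    (trans (sum-range (λ x → sum (map (weight n s t x) (range 1 n))) n)
           (Σ-cong n λ i → sum-range (weight n s t (suc i)) n))

  -- Pairs with `x + 3y ≤ m` and `y ≤ b`, counted by columns.

  σ : ℕ → ℕ → ℕ
  σ b m = Σ[ k < b ] (m ∸ 3 * suc k)

  σ-suc : ∀ b m → σ (suc b) m ≡ (m ∸ 3) + σ b (m ∸ 3)
  σ-suc b m = cong (m ∸ 3 +_) (Σ-cong b λ k → trans (cong (m ∸_) (*-suc 3 (suc k))) (sym (∸-+-assoc m 3 (3 * suc k))))

  σ-0 : ∀ b → σ b 0 ≡ 0
  σ-0 b = trans (Σ-cong b λ k → 0∸n≡0 (3 * suc k)) (Σ-zero b)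

  σ≤τ : ∀ b m → σ b m ≤ τ m
  σ≤τ zero    m = z≤n
  σ≤τ (suc b) 0 = ≤-reflexive (σ-0 (suc b))
  σ≤τ (suc b) 1 = ≤-reflexive (trans (σ-suc b 1) (σ-0 b))
  σ≤τ (suc b) 2 = ≤-reflexive (trans (σ-suc b 2) (σ-0 b))
  σ≤τ (suc b) (suc (suc (suc m))) = ≤-trans (≤-reflexive (σ-suc b (3 + m))) (+-monoʳ-≤ m (σ≤τ b m))

  -- A pair with `y > b` has `x + 3y ≥ 4 + 3b`, so up to `m = 3 + 3 * b` the cap on `y` loses
  -- nothing. This bound later separates narrow from wider last red blocks.
  τ≤σ : ∀ b m → m ≤ 3 + 3 * b → τ m ≤ σ b m
  τ≤σ b 0 _ = z≤n
  τ≤σ b 1 _ = z≤n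
  τ≤σ b 2 _ = z≤n
  τ≤σ zero    (suc (suc (suc zero)))    _ = z≤n
  τ≤σ zero    (suc (suc (suc (suc m)))) (s≤s (s≤s (s≤s ())))
  τ≤σ (suc b) (suc (suc (suc m))) (s≤s (s≤s (s≤s h))) =
    ≤-trans (+-monoʳ-≤ m (τ≤σ b m (≤-trans h (≤-reflexive (*-suc 3 b))))) (≤-reflexive (sym (σ-suc b (3 + m))))

  -- Undoing the truncation of `m ∸ 3 * suc k` only lowers the terms, and the resulting arithmetic
  -- progression has a closed sum. Doubling avoids the half, and the negative part is moved to the
  -- right.
  σ-lower : ∀ b m → 2 * (b * m) ≤ 2 * σ b m + 3 * (b * suc b)
  σ-lower zero    m = z≤n
  σ-lower (suc b) m = begin
    2 * (suc b * m)                                                ≤⟨ *-monoʳ-≤ 2 (*-monoʳ-≤ (suc b) (m≤n+m∸n m 3)) ⟩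
    2 * (suc b * (3 + m′))                                         ≡⟨ expand b m′ ⟩
    2 * (b * m′) + (2 * m′ + 6 * suc b)                            ≤⟨ +-monoˡ-≤ _ (σ-lower b m′) ⟩
    2 * σ b m′ + 3 * (b * suc b) + (2 * m′ + 6 * suc b)            ≡⟨ collect (σ b m′) b m′ ⟩
    2 * (m′ + σ b m′) + 3 * (suc b * suc (suc b))                  ≡⟨ cong (λ z → 2 * z + 3 * (suc b * suc (suc b))) (σ-suc b m) ⟨
    2 * σ (suc b) m + 3 * (suc b * suc (suc b))                    ∎
    where
    open ≤-Reasoning
    m′ = m ∸ 3
    expand : ∀ b m → 2 * (suc b * (3 + m)) ≡ 2 * (b * m) + (2 * m + 6 * suc b)
    expand = solve-∀
    collect : ∀ z b m → 2 * z + 3 * (b * suc b) + (2 * m + 6 * suc b) ≡ 2 * (m + z) + 3 * (suc b * suc (suc b))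
    collect = solve-∀

  -- For fixed `y`, with `e = 3y`, the condition `x ≤ a` does not bind when `m ≤ a`, so only
  -- `1 ≤ x ≤ m - e` remains.
  column : ∀ a e m → m ≤ a → Σ[ i < a ] b2n (suc i + e ≤ᵇ m) ≡ m ∸ e
  column a       e zero    _         = trans (Σ-zero a) (sym (0∸n≡0 e))
  column (suc a) e (suc m) (s≤s m≤a) with column a e m m≤a | e ≤? m
  ... | ih | yes e≤m = trans (cong₂ _+_ (one e≤m) ih) (sym (+-∸-assoc 1 e≤m))
    where
    one : ∀ {e m} → e ≤ m → b2n (e <ᵇ suc m) ≡ 1
    one {e} {m} e≤m with e <ᵇ suc m | <⇒<ᵇ (s≤s e≤m)
    ... | true | _ = refl
  ... | ih | no e≰m = trans (cong₂ _+_ (nil e≰m) (trans ih (m≤n⇒m∸n≡0 (<⇒≤ (≰⇒> e≰m))))) (sym (m≤n⇒m∸n≡0 (≰⇒> e≰m)))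
    where
    nil : ∀ {e m} → ¬ e ≤ m → b2n (e <ᵇ suc m) ≡ 0
    nil {e} {m} e≰m with e <ᵇ suc m | <ᵇ⇒< e (suc m)
    ... | true  | lt = ⊥-elim (e≰m (s≤s⁻¹ (lt tt)))
    ... | false | _  = refl

  triangle : ℕ → ℕ → ℕ → ℕ
  triangle a b m = Σ[ i < a ] Σ[ k < b ] b2n (suc i + 3 * suc k ≤ᵇ m)

  triangle≡σ : ∀ a b m → m ≤ a → triangle a b m ≡ σ b m
  triangle≡σ a b m m≤a = trans (Σ-swap a b (λ i k → b2n (suc i + 3 * suc k ≤ᵇ m))) (Σ-cong b λ k → column a (3 * suc k) m m≤a)

  b2n-mono : ∀ {a b} → (T a → T b) → b2n a ≤ b2n b
  b2n-mono {false}         h = z≤n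
  b2n-mono {true}  {true}  h = ≤-refl
  b2n-mono {true}  {false} h = ⊥-elim (h tt)

  b2n-⊥ : ∀ {a} → ¬ T a → b2n a ≤ 0
  b2n-⊥ {false} h = z≤n
  b2n-⊥ {true}  h = ⊥-elim (h tt)

  -- Boolean colour tests as predicates open to case analysis.

  module Colouring (n s t : ℕ) where

    data Red (k : ℕ) : Set where
      below : k ≤ s → Red k
      above : t < k → Red k

    data Blue (k : ℕ) : Set where
      between : s < k → k ≤ t → Blue k

    ¬red∧blue : ∀ {k} → Red k → Blue k → ⊥
    ¬red∧blue (below k≤s) (between s<k _) = <⇒≱ s<k k≤s
    ¬red∧blue (above t<k) (between _ k≤t) = <⇒≱ t<k k≤t

    isRed⁺ : ∀ k → Red k → T (isRed s t k)
    isRed⁺ k (below k≤s) = Equivalence.from T-∨ (inj₁ (≤⇒≤ᵇ k≤s))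
    isRed⁺ k (above t<k) = Equivalence.from (T-∨ {k ≤ᵇ s}) (inj₂ (<⇒<ᵇ t<k))

    isRed⁻ : ∀ k → T (isRed s t k) → Red k
    isRed⁻ k h with Equivalence.to (T-∨ {k ≤ᵇ s}) h
    ... | inj₁ p = below (≤ᵇ⇒≤ k s p)
    ... | inj₂ p = above (<ᵇ⇒< t k p)

    isBlue⁺ : ∀ k → Blue k → T (isBlue s t k)
    isBlue⁺ k (between s<k k≤t) = Equivalence.from T-∧ (<⇒<ᵇ s<k , ≤⇒≤ᵇ k≤t)

    isBlue⁻ : ∀ k → T (isBlue s t k) → Blue k
    isBlue⁻ k h with Equivalence.to (T-∧ {s <ᵇ k}) h
    ... | p , p′ = between (<ᵇ⇒< s k p) (≤ᵇ⇒≤ k t p′)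

    T-∧₃ : ∀ a b {c} → T a → T b → T c → T (a ∧ b ∧ c)
    T-∧₃ true true _ _ p = p

    T-∧₃⁻ : ∀ a b {c} → T (a ∧ b ∧ c) → T a × T b × T c
    T-∧₃⁻ true true p = tt , tt , p

    good-red : ∀ x y → x + 3 * y ≤ n → Red x → Red y → Red (x + 3 * y) → T (good n s t x y)
    good-red x y z≤ rx ry rz = Equivalence.from T-∧ (≤⇒≤ᵇ z≤ , Equivalence.from T-∨ (inj₁
      (T-∧₃ (isRed s t x) (isRed s t y) (isRed⁺ x rx) (isRed⁺ y ry) (isRed⁺ (x + 3 * y) rz))))

    good-blue : ∀ x y → x + 3 * y ≤ n → Blue x → Blue y → Blue (x + 3 * y) → T (good n s t x y)
    good-blue x y z≤ bx by bz = Equivalence.from T-∧ (≤⇒≤ᵇ z≤ ,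
      Equivalence.from (T-∨ {isRed s t x ∧ isRed s t y ∧ isRed s t (x + 3 * y)}) (inj₂
        (T-∧₃ (isBlue s t x) (isBlue s t y) (isBlue⁺ x bx) (isBlue⁺ y by) (isBlue⁺ (x + 3 * y) bz))))

    good⁻ : ∀ x y → T (good n s t x y) →
            x + 3 * y ≤ n × (Red x × Red y × Red (x + 3 * y) ⊎ Blue x × Blue y × Blue (x + 3 * y))
    good⁻ x y h with Equivalence.to (T-∧ {x + 3 * y ≤ᵇ n}) h
    ... | p , p′ = ≤ᵇ⇒≤ (x + 3 * y) n p , Sum.map reds blues
          (Equivalence.to (T-∨ {isRed s t x ∧ isRed s t y ∧ isRed s t (x + 3 * y)}) p′)
      where
      reds : T (isRed s t x ∧ isRed s t y ∧ isRed s t (x + 3 * y)) → Red x × Red y × Red (x + 3 * y)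
      reds h = let rx , ry , rz = T-∧₃⁻ (isRed s t x) (isRed s t y) h
               in isRed⁻ x rx , isRed⁻ y ry , isRed⁻ (x + 3 * y) rz
      blues : T (isBlue s t x ∧ isBlue s t y ∧ isBlue s t (x + 3 * y)) → Blue x × Blue y × Blue (x + 3 * y)
      blues h = let bx , by , bz = T-∧₃⁻ (isBlue s t x) (isBlue s t y) h
                in isBlue⁻ x bx , isBlue⁻ y by , isBlue⁻ (x + 3 * y) bz

  -- If `a < b`, then `a ∸ b` is 0, which `1 ≤ m` excludes; otherwise the subtraction is genuine.
  m≤a∸b⇒m+b≤a : ∀ {m} a b → 1 ≤ m → m ≤ a ∸ b → m + b ≤ a
  m≤a∸b⇒m+b≤a {m} a b 1≤m h with b ≤? a
  ... | yes b≤a = m≤o∸n⇒m+n≤o m b≤a h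
  ... | no  b≰a = ⊥-elim (<⇒≱ 1≤m (≤-trans h (≤-reflexive (m≤n⇒m∸n≡0 (<⇒≤ (≰⇒> b≰a))))))

  -- The nine products of blocks for `x` and `y`, and a lower bound for every colouring.

  module Blocks (s q r : ℕ) where

    t = s + q
    n = s + q + r

    open Colouring n s t

    cell : ℕ → ℕ → ℕ
    cell i k = weight n s t (suc i) (suc k)

    part₀ part₁ part₂ row : ℕ → ℕ
    part₀ i = Σ[ k < s ] cell i k
    part₁ i = Σ[ k < q ] cell i (s + k)
    part₂ i = Σ[ k < r ] cell i (t + k)
    row i = part₀ i + part₁ i + part₂ i

    M-blocks : M3nst n s t ≡ Σ[ i < s ] row i + Σ[ i < q ] row (s + i) + Σ[ i < r ] row (t + i)
    M-blocks = trans (M3nst-Σ n s t) (trans (Σ-cong n λ i → Σ-split₃ s q r (cell i)) (Σ-split₃ s q r row))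

    shift-x : ∀ a i k → suc (a + i) + 3 * suc k ≡ suc i + 3 * suc k + a
    shift-x = solve-∀

    -- Moving both `x` and `y` by `a` moves `z` by `4a`. Measured from the start `a` of a block, `z`
    -- loses `3a` of room, which is the source of `q ∸ 3 * s` and `r ∸ 3 * t`.
    shift-xy : ∀ a i k → suc (a + i) + 3 * suc (a + k) ≡ suc i + 3 * suc k + 3 * a + a
    shift-xy = solve-∀

    s≤t : s ≤ t
    s≤t = m≤m+n s q

    t≤n : t ≤ n
    t≤n = m≤m+n t r

    beyond : ∀ {a} i → a < suc (a + i)
    beyond {a} i = s≤s (m≤m+n a i)

    beyond-z : ∀ {a} i e → a < suc (a + i) + e
    beyond-z i e = ≤-trans (beyond i) (m≤m+n _ e)

    good₀₀ : ∀ i k → i < s → k < s → suc i + 3 * suc k ≤ s → T (good n s t (suc i) (suc k))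
    good₀₀ i k i<s k<s z≤s =
      good-red (suc i) (suc k) (≤-trans z≤s (≤-trans s≤t t≤n)) (below i<s) (below k<s) (below z≤s)

    good₁₁ : ∀ i k → i < q → k < q → suc i + 3 * suc k ≤ q ∸ 3 * s → T (good n s t (suc (s + i)) (suc (s + k)))
    good₁₁ i k i<q k<q h =
      good-blue (suc (s + i)) (suc (s + k)) (≤-trans z≤t t≤n)
        (between (beyond i) (+-monoʳ-< s i<q)) (between (beyond k) (+-monoʳ-< s k<q)) (between (beyond-z i _) z≤t)
      where
      z≤t : suc (s + i) + 3 * suc (s + k) ≤ t
      z≤t = ≤-trans (≤-reflexive (shift-xy s i k))
        (≤-trans (+-monoˡ-≤ s (m≤a∸b⇒m+b≤a q (3 * s) (s≤s z≤n) h)) (≤-reflexive (+-comm q s)))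

    good₂₀ : ∀ i k → k < s → suc i + 3 * suc k ≤ r → T (good n s t (suc (t + i)) (suc k))
    good₂₀ i k k<s h =
      good-red (suc (t + i)) (suc k)
        (≤-trans (≤-reflexive (shift-x t i k)) (≤-trans (+-monoˡ-≤ t h) (≤-reflexive (+-comm r t))))
        (above (beyond i)) (below k<s) (above (beyond-z i _))

    good₂₂ : ∀ i k → suc i + 3 * suc k ≤ r ∸ 3 * t → T (good n s t (suc (t + i)) (suc (t + k)))
    good₂₂ i k h =
      good-red (suc (t + i)) (suc (t + k))
        (≤-trans (≤-reflexive (shift-xy t i k))
          (≤-trans (+-monoˡ-≤ t (m≤a∸b⇒m+b≤a r (3 * t) (s≤s z≤n) h)) (≤-reflexive (+-comm r t))))
        (above (beyond i)) (above (beyond k)) (above (beyond-z i _))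

    -- Four disjoint families are counted: all three terms in the first red block; all three blue;
    -- `x`, `z` last red with `y` first red; all three last red. Triples with `x` first red and `z`
    -- last red are dropped, hence only an inequality.
    lower : τ s + σ s r + τ (q ∸ 3 * s) + τ (r ∸ 3 * t) ≤ M3nst n s t
    lower = begin
      τ s + σ s r + τ (q ∸ 3 * s) + τ (r ∸ 3 * t)
        ≤⟨ +-mono-≤ (+-mono-≤ (+-monoˡ-≤ (σ s r) (τ≤triangle s s ≤-refl (≤-trans (m≤n*m s 3) (m≤n+m _ 3))))
                              (τ≤triangle q (q ∸ 3 * s) (m∸n≤m q (3 * s)) (≤-trans (m∸n≤m q (3 * s)) (≤-trans (m≤n*m q 3) (m≤n+m _ 3)))))
                    (τ≤triangle r (r ∸ 3 * t) (m∸n≤m r (3 * t)) (≤-trans (m∸n≤m r (3 * t)) (≤-trans (m≤n*m r 3) (m≤n+m _ 3)))) ⟩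
      triangle s s s + σ s r + triangle q q (q ∸ 3 * s) + triangle r r (r ∸ 3 * t)
        ≡⟨ cong (λ z → triangle s s s + z + triangle q q (q ∸ 3 * s) + triangle r r (r ∸ 3 * t)) (triangle≡σ r s r ≤-refl) ⟨
      triangle s s s + triangle r s r + triangle q q (q ∸ 3 * s) + triangle r r (r ∸ 3 * t)
        ≡⟨ regroup (triangle s s s) (triangle r s r) (triangle q q (q ∸ 3 * s)) (triangle r r (r ∸ 3 * t)) ⟩
      triangle s s s + triangle q q (q ∸ 3 * s) + (triangle r s r + triangle r r (r ∸ 3 * t))
        ≤⟨ +-mono-≤ (+-mono-≤ red₀ blue) red₂ ⟩
      Σ[ i < s ] row i + Σ[ i < q ] row (s + i) + Σ[ i < r ] row (t + i)
        ≡⟨ M-blocks ⟨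
      M3nst n s t ∎
      where
      open ≤-Reasoning
      regroup : ∀ a b c d → a + b + c + d ≡ a + c + (b + d)
      regroup = solve-∀
      τ≤triangle : ∀ a m → m ≤ a → m ≤ 3 + 3 * a → τ m ≤ triangle a a m
      τ≤triangle a m m≤a h = ≤-trans (τ≤σ a m h) (≤-reflexive (sym (triangle≡σ a a m m≤a)))
      red₀ : triangle s s s ≤ Σ[ i < s ] row i
      red₀ = Σ-mono s λ i i<s → ≤-trans
        (Σ-mono s λ k k<s → b2n-mono (good₀₀ i k i<s k<s ∘ ≤ᵇ⇒≤ (suc i + 3 * suc k) s))
        (≤-trans (m≤m+n (part₀ i) (part₁ i)) (m≤m+n (part₀ i + part₁ i) (part₂ i)))
      blue : triangle q q (q ∸ 3 * s) ≤ Σ[ i < q ] row (s + i)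
      blue = Σ-mono q λ i i<q → ≤-trans
        (Σ-mono q λ k k<q → b2n-mono (good₁₁ i k i<q k<q ∘ ≤ᵇ⇒≤ (suc i + 3 * suc k) (q ∸ 3 * s)))
        (≤-trans (m≤n+m (part₁ (s + i)) (part₀ (s + i))) (m≤m+n (part₀ (s + i) + part₁ (s + i)) (part₂ (s + i))))
      red₂ : triangle r s r + triangle r r (r ∸ 3 * t) ≤ Σ[ i < r ] row (t + i)
      red₂ = ≤-trans
        (≤-reflexive (sym (Σ-distrib-+ r (λ i → Σ[ k < s ] b2n (suc i + 3 * suc k ≤ᵇ r))
                                         (λ i → Σ[ k < r ] b2n (suc i + 3 * suc k ≤ᵇ r ∸ 3 * t)))))
        (Σ-mono r λ i i<r → +-mono-≤
          (≤-trans (Σ-mono s λ k k<s → b2n-mono (good₂₀ i k k<s ∘ ≤ᵇ⇒≤ (suc i + 3 * suc k) r))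
                   (m≤m+n (part₀ (t + i)) (part₁ (t + i))))
          (Σ-mono r λ k k<r → b2n-mono (good₂₂ i k ∘ ≤ᵇ⇒≤ (suc i + 3 * suc k) (r ∸ 3 * t))))

    -- The matching upper bound for well-proportioned blocks.

    module _ (3s≤q : 3 * s ≤ q) (r≤2t : r ≤ 2 * t) where

      n≤3t : n ≤ 3 * t
      n≤3t = ≤-trans (+-monoʳ-≤ t r≤2t) (≤-reflexive (collect t))
        where
        collect : ∀ t → t + 2 * t ≡ 3 * t
        collect = solve-∀

      red-blue : ∀ x y → Red x → Blue y → ¬ T (good n s t x y)
      red-blue x y rx by g with good⁻ x y g
      ... | _ , inj₁ (_ , ry , _) = ¬red∧blue ry by
      ... | _ , inj₂ (bx , _ , _) = ¬red∧blue rx bx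

      blue-red : ∀ x y → Blue x → Red y → ¬ T (good n s t x y)
      blue-red x y bx ry g with good⁻ x y g
      ... | _ , inj₁ (rx , _ , _) = ¬red∧blue rx bx
      ... | _ , inj₂ (_ , by , _) = ¬red∧blue ry by

      high-y : ∀ x y → t < y → ¬ T (good n s t x y)
      high-y x y t<y g = <⇒≱ (*-monoʳ-< 3 t<y) (≤-trans (m≤n+m (3 * y) x) (≤-trans (proj₁ (good⁻ x y g)) n≤3t))

      -- Here `x + 3y ≤ 4s ≤ t` by `3s≤q`, so `z` cannot jump over the blue block into the last red
      -- one.
      low-low : ∀ x y → x ≤ s → y ≤ s → T (good n s t x y) → x + 3 * y ≤ s
      low-low x y x≤s y≤s g with good⁻ x y g
      ... | _ , inj₂ (bx , _ , _)        = ⊥-elim (¬red∧blue (below x≤s) bx)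
      ... | _ , inj₁ (_ , _ , below z≤s) = z≤s
      ... | _ , inj₁ (_ , _ , above t<z) =
        ⊥-elim (<⇒≱ t<z (≤-trans (+-mono-≤ x≤s (*-monoʳ-≤ 3 y≤s)) (+-monoʳ-≤ s 3s≤q)))

      blue-blue : ∀ x y → Blue x → T (good n s t x y) → x + 3 * y ≤ t
      blue-blue x y bx g with good⁻ x y g
      ... | _ , inj₁ (rx , _ , _)              = ⊥-elim (¬red∧blue rx bx)
      ... | _ , inj₂ (_ , _ , between _ z≤t)   = z≤t

      mid : ∀ {i} → i < q → Blue (suc (s + i))
      mid {i} i<q = between (beyond i) (+-monoʳ-< s i<q)

      vanish : ∀ l i a → (∀ k → k < l → ¬ T (good n s t (suc i) (suc (a + k)))) → Σ[ k < l ] cell i (a + k) ≤ 0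
      vanish l i a h = ≤-trans (Σ-mono l λ k k<l → b2n-⊥ (h k k<l)) (≤-reflexive (Σ-zero l))

      row-≤ : ∀ i {a b c} → part₀ i ≤ a → part₁ i ≤ b → part₂ i ≤ c →
              row i ≤ a + b + c
      row-≤ i h h′ h″ = +-mono-≤ (+-mono-≤ h h′) h″

      row₀ : ∀ i → i < s → row i ≤ Σ[ k < s ] b2n (suc i + 3 * suc k ≤ᵇ s)
      row₀ i i<s = ≤-trans
        (row-≤ i (Σ-mono s λ k k<s → b2n-mono (≤⇒≤ᵇ ∘ low-low (suc i) (suc k) i<s k<s))
          (vanish q i s λ k k<q → red-blue (suc i) (suc (s + k)) (below i<s) (mid k<q))
          (vanish r i t λ k _ → high-y (suc i) (suc (t + k)) (beyond k)))
        (≤-reflexive (trans (+-identityʳ _) (+-identityʳ _)))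

      row₁ : ∀ i → i < q → row (s + i) ≤ Σ[ k < q ] b2n (suc i + 3 * suc k ≤ᵇ q ∸ 3 * s)
      row₁ i i<q = ≤-trans
        (row-≤ (s + i)
          (vanish s (s + i) 0 λ k k<s → blue-red (suc (s + i)) (suc k) (mid i<q) (below k<s))
          (Σ-mono q λ k _ → b2n-mono λ g → ≤⇒≤ᵇ (m+n≤o⇒m≤o∸n (suc i + 3 * suc k)
            (+-cancelʳ-≤ s _ q (≤-trans (≤-reflexive (sym (shift-xy s i k)))
              (≤-trans (blue-blue (suc (s + i)) (suc (s + k)) (mid i<q) g) (≤-reflexive (+-comm s q)))))))
          (vanish r (s + i) t λ k _ → high-y (suc (s + i)) (suc (t + k)) (beyond k)))
        (≤-reflexive (+-identityʳ _))

      row₂ : ∀ i → i < r → row (t + i) ≤ Σ[ k < s ] b2n (suc i + 3 * suc k ≤ᵇ r)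
      row₂ i _ = ≤-trans
        (row-≤ (t + i) (Σ-mono s λ k _ → b2n-mono λ g → ≤⇒≤ᵇ
            (+-cancelʳ-≤ t _ r (≤-trans (≤-reflexive (sym (shift-x t i k)))
              (≤-trans (proj₁ (good⁻ (suc (t + i)) (suc k) g)) (≤-reflexive (+-comm t r))))))
          (vanish q (t + i) s λ k k<q →
            red-blue (suc (t + i)) (suc (s + k)) (above (beyond i)) (mid k<q))
          (vanish r (t + i) t λ k _ → high-y (suc (t + i)) (suc (t + k)) (beyond k)))
        (≤-reflexive (trans (+-identityʳ _) (+-identityʳ _)))

      -- Of the nine products, those with `y` last red vanish because `3y > n`, and those pairing
      -- red with blue are not monochromatic. First red with itself, blue with itself, and `x` last
      -- red with `y` first red remain.
      upper : M3nst n s t ≤ τ s + τ (q ∸ 3 * s) + τ r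
      upper = ≤-trans (≤-reflexive M-blocks) (+-mono-≤ (+-mono-≤
        (triangle-≤ s s (Σ-mono s row₀) ≤-refl) (triangle-≤ q q (Σ-mono q row₁) (m∸n≤m q (3 * s))))
        (triangle-≤ r s (Σ-mono r row₂) ≤-refl))
        where
        triangle-≤ : ∀ a b {z m} → z ≤ triangle a b m → m ≤ a → z ≤ τ m
        triangle-≤ a b {z} {m} h m≤a = ≤-trans h (≤-trans (≤-reflexive (triangle≡σ a b m m≤a)) (σ≤τ b m))

module Optimisation where

  open import Data.Nat as ℕ using (ℕ; zero; suc; z≤n; s≤s; z<s)
  import Data.Nat.Properties as ℕ
  import Data.Nat.DivMod as ℕ
  import Data.Nat.Tactic.RingSolver as ℕ-Solver
  open import Data.Integer using (ℤ; +_; -[1+_]; _+_; _-_; _*_; -_; _≤_; _<_; +≤+; 0ℤ; 1ℤ; -1ℤ; _/_; _≤?_)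
  import Data.Integer.Properties as ℤ
  open import Data.Integer.DivMod using ([n/d]*d≤n; n<s[n/ℕd]*d; div-pos-is-/ℕ)
  open import Data.Integer.Tactic.RingSolver using (solve-∀)
  open Counting

  -- Building nonnegative integers for certified inequalities.

  infixl 6 _⊕_
  _⊕_ : ∀ {i j} → 0ℤ ≤ i → 0ℤ ≤ j → 0ℤ ≤ i + j
  _⊕_ = ℤ.+-mono-≤

  infixl 7 _⊗_
  _⊗_ : ∀ {i j} → 0ℤ ≤ i → 0ℤ ≤ j → 0ℤ ≤ i * j
  _⊗_ {+ m} {+ n} _ _ = subst (0ℤ ≤_) (ℤ.pos-* m n) (+≤+ z≤n)

  +≥0 : ∀ n → 0ℤ ≤ + n
  +≥0 n = +≤+ z≤n

  square : ∀ i → 0ℤ ≤ i * i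
  square (+ n)    = +≥0 n ⊗ +≥0 n
  square -[1+ n ] = +≤+ z≤n

  gap : ∀ {i j} → i ≤ j → 0ℤ ≤ j - i
  gap = ℤ.i≤j⇒0≤j-i

  -- The form of the quadratic estimates below: `k` is assembled from squares and products of
  -- nonnegative terms, and the ring solver supplies the equation.
  ≤-by : ∀ {i j k} → 0ℤ ≤ k → j - i ≡ k → i ≤ j
  ≤-by h eq = ℤ.0≤i-j⇒j≤i (subst (0ℤ ≤_) (sym eq) h)

  -- `τ` as a square up to an error depending on divisibility by 3.

  data τ-Square (m : ℕ) : Set where
    triple    : ∀ k → m ≡ 3 ℕ.* k → (+ 2 * + m - + 3) * (+ 2 * + m - + 3) ≡ + 24 * + τ m + + 9 → τ-Square m
    nontriple : (+ 2 * + m - + 3) * (+ 2 * + m - + 3) ≡ + 24 * + τ m + + 1 → τ-Square m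

  -- `(2m + 3)² - (2m - 3)² = 24m` matches the recursion of `τ`, so the error `e` is kept along a
  -- residue class modulo 3.
  τ-step : ∀ m t e → (+ 2 * m - + 3) * (+ 2 * m - + 3) ≡ + 24 * t + e →
           (+ 2 * (+ 3 + m) - + 3) * (+ 2 * (+ 3 + m) - + 3) ≡ + 24 * (m + t) + e
  τ-step m t e eq = trans (shift m) (trans (cong (λ z → + 24 * m + z) eq) (regroup m t e))
    where
    shift : ∀ m → (+ 2 * (+ 3 + m) - + 3) * (+ 2 * (+ 3 + m) - + 3)
                ≡ + 24 * m + (+ 2 * m - + 3) * (+ 2 * m - + 3)
    shift = solve-∀
    regroup : ∀ m t e → + 24 * m + (+ 24 * t + e) ≡ + 24 * (m + t) + e
    regroup = solve-∀

  τ-square : ∀ m → τ-Square m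
  τ-square 0 = triple 0 refl refl
  τ-square 1 = nontriple refl
  τ-square 2 = nontriple refl
  τ-square (suc (suc (suc m))) with τ-square m
  ... | triple k eq sq = triple (suc k) (trans (cong (3 ℕ.+_) eq) (sym (ℕ.*-suc 3 k))) (τ-step (+ m) (+ τ m) (+ 9) sq)
  ... | nontriple sq   = nontriple (τ-step (+ m) (+ τ m) (+ 1) sq)

  τ-below : ∀ m → (+ 2 * + m - + 3) * (+ 2 * + m - + 3) ≤ + 24 * + τ m + + 9
  τ-below m with τ-square m
  ... | triple _ _ sq = ℤ.≤-reflexive sq
  ... | nontriple sq = ℤ.≤-trans (ℤ.≤-reflexive sq) (ℤ.+-monoʳ-≤ (+ 24 * + τ m) (from-yes (+ 1 ≤? + 9)))

  τ-above : ∀ m → + 24 * + τ m + + 1 ≤ (+ 2 * + m - + 3) * (+ 2 * + m - + 3)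
  τ-above m with τ-square m
  ... | triple _ _ sq = ℤ.≤-trans (ℤ.+-monoʳ-≤ (+ 24 * + τ m) (from-yes (+ 1 ≤? + 9))) (ℤ.≤-reflexive (sym sq))
  ... | nontriple sq = ℤ.≤-reflexive (sym sq)

  -- For S = 2s - 3, R = 2r - 3, C = 2c - 3 the last three squares of Lagrange's identity sum to imbalance (3 + s) r c;
  -- with this shift, dividing s, r and c by 3 just divides it by 9.
  imbalance : ℤ → ℤ → ℤ → ℤ
  imbalance s r c = (+ 2 * (s - + 4 * r) + + 3) * (+ 2 * (s - + 4 * r) + + 3)
                  + (+ 2 * (s - + 4 * c) + + 3) * (+ 2 * (s - + 4 * c) + + 3)
                  + (+ 2 * (r - c)) * (+ 2 * (r - c))

  imbalance≥0 : ∀ s r c → 0ℤ ≤ imbalance s r c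
  imbalance≥0 s r c = square (+ 2 * (s - + 4 * r) + + 3) ⊕ square (+ 2 * (s - + 4 * c) + + 3) ⊕ square (+ 2 * (r - c))

  -- Distance of a triple from the proportion 4 : 1 : 1.

  data Near (s r c : ℕ) : Set where
    far    : + 36 ≤ imbalance (+ s) (+ r) (+ c) → Near s r c
    middle : ∀ k → k ≡ 0 ⊎ k ≡ 3 → r ≡ c → s ℕ.+ k ≡ 4 ℕ.* r → + 18 ≤ imbalance (+ s) (+ r) (+ c) → Near s r c
    close  : ∀ k → k ≡ 1 ⊎ k ≡ 2 → r ≡ c → s ℕ.+ k ≡ 4 ℕ.* r → Near s r c

  1≤square : ∀ i → i ≢ 0ℤ → 1ℤ ≤ i * i
  1≤square (+ zero)  i≢0 = ⊥-elim (i≢0 refl)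
  1≤square (+ suc n) _   = +≤+ (s≤s z≤n)
  1≤square -[1+ n ]  _   = +≤+ (s≤s z≤n)

  -- With `x = 2(s - 4r) + 3` and `d = r - c` the imbalance is `2(x + 4d)² + 36d²`.
  imbalance-unbalanced : ∀ s r c → 1ℤ ≤ (r - c) * (r - c) → + 36 ≤ imbalance s r c
  imbalance-unbalanced s r c h =
    ≤-by (+≥0 2 ⊗ square (+ 2 * (s - + 4 * r) + + 3 + + 4 * (r - c)) ⊕ +≥0 36 ⊗ gap h) (expand s r c)
    where
    expand : ∀ s r c →
      (+ 2 * (s - + 4 * r) + + 3) * (+ 2 * (s - + 4 * r) + + 3)
        + (+ 2 * (s - + 4 * c) + + 3) * (+ 2 * (s - + 4 * c) + + 3)
        + (+ 2 * (r - c)) * (+ 2 * (r - c)) - + 36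
      ≡ + 2 * ((+ 2 * (s - + 4 * r) + + 3 + + 4 * (r - c)) * (+ 2 * (s - + 4 * r) + + 3 + + 4 * (r - c)))
        + + 36 * ((r - c) * (r - c) - 1ℤ)
    expand = solve-∀

  imbalance-balanced : ∀ s r p → s - + 4 * r ≡ p → imbalance s r r ≡ + 2 * ((+ 2 * p + + 3) * (+ 2 * p + + 3))
  imbalance-balanced s r p refl = collapse (+ 2 * (s - + 4 * r) + + 3) r
    where
    collapse : ∀ x r → x * x + x * x + + 2 * (r - r) * (+ 2 * (r - r)) ≡ + 2 * (x * x)
    collapse = solve-∀

  difference-neg : ∀ s r k → + s - + 4 * + r ≡ - + k → s ℕ.+ k ≡ 4 ℕ.* r
  difference-neg s r k eq = ℤ.+-injective (begin
    + s + + k                                ≡⟨ rearrange (+ s) (+ r) (+ k) ⟩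
    (+ s - + 4 * + r) + + k + + 4 * + r      ≡⟨ cong (λ p → p + + k + + 4 * + r) eq ⟩
    - + k + + k + + 4 * + r                  ≡⟨ cancel (+ k) (+ 4 * + r) ⟩
    + 4 * + r                                ≡⟨ ℤ.pos-* 4 r ⟨
    + (4 ℕ.* r)                              ∎)
    where
    open ≡-Reasoning
    rearrange : ∀ s r k → s + k ≡ (s - + 4 * r) + k + + 4 * r
    rearrange = solve-∀
    cancel : ∀ k x → - k + k + x ≡ x
    cancel = solve-∀

  -- For `r = c` and `p = s - 4r` the imbalance is `2(2p + 3)²`: it is 2 at `p = -1, -2`, 18 at
  -- `p = 0, -3`, and at least 50 elsewhere. For `r ≠ c` it is at least 36. The index `k` of `Near`
  -- is `-p`.
  near : ∀ s r c → Near s r c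
  near s r c with r ℕ.≟ c
  ... | no r≢c = far (imbalance-unbalanced (+ s) (+ r) (+ c)
                       (1≤square (+ r - + c) λ eq → r≢c (ℤ.+-injective (ℤ.i-j≡0⇒i≡j (+ r) (+ c) eq))))
  ... | yes refl with + s - + 4 * + r in eq
  ...   | + 0           = middle 0 (inj₁ refl) refl (difference-neg s r 0 eq)
                            (ℤ.≤-reflexive (sym (imbalance-balanced (+ s) (+ r) (+ 0) eq)))
  ...   | -[1+ 0 ]      = close 1 (inj₁ refl) refl (difference-neg s r 1 eq)
  ...   | -[1+ 1 ]      = close 2 (inj₂ refl) refl (difference-neg s r 2 eq)
  ...   | -[1+ 2 ]      = middle 3 (inj₂ refl) refl (difference-neg s r 3 eq)
                            (ℤ.≤-reflexive (sym (imbalance-balanced (+ s) (+ r) -[1+ 2 ] eq)))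
  ...   | + suc n       = far (≤-by (+≥0 14 ⊕ +≥0 40 ⊗ +≥0 n ⊕ +≥0 8 ⊗ +≥0 n ⊗ +≥0 n)
                                (trans (cong (_- + 36) (imbalance-balanced (+ s) (+ r) (1ℤ + + n) eq)) (expand (+ n))))
    where
    expand : ∀ n → + 2 * ((+ 2 * (1ℤ + n) + + 3) * (+ 2 * (1ℤ + n) + + 3)) - + 36
                 ≡ + 14 + + 40 * n + + 8 * n * n
    expand = solve-∀
  ...   | -[1+ suc (suc (suc n)) ] =
    far (≤-by (+≥0 14 ⊕ +≥0 40 ⊗ +≥0 n ⊕ +≥0 8 ⊗ +≥0 n ⊗ +≥0 n)
          (trans (cong (_- + 36) (imbalance-balanced (+ s) (+ r) (- (+ 4 + + n)) eq)) (expand (+ n))))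
    where
    expand : ∀ n → + 2 * ((+ 2 * (- (+ 4 + n)) + + 3) * (+ 2 * (- (+ 4 + n)) + + 3)) - + 36
                 ≡ + 14 + + 40 * n + + 8 * n * n
    expand = solve-∀

  -- The closed formula and floor division by 108.

  numeratorℤ : ℤ → ℤ
  numeratorℤ n = n * n - + 18 * n + + 101

  numerator : ℕ → ℤ
  numerator n = numeratorℤ (+ n)

  correction : ℕ → ℤ
  correction m = if m ℕ.≡ᵇ 36 then 1ℤ else (if (m ℕ.≡ᵇ 30) ∨ (m ℕ.≡ᵇ 42) then -1ℤ else 0ℤ)

  formula : ℕ → ℤ
  formula n = numerator n / + 108 + correction (n ℕ.% 54)

  <suc⇒≤ : ∀ i j → i < 1ℤ + j → i ≤ j
  <suc⇒≤ i j h = subst₂ _≤_ (ℤ.pred-suc i) (ℤ.pred-suc j) (ℤ.pred-mono (ℤ.i<j⇒suc[i]≤j h))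

  *108-cancel-< : ∀ i j → + 108 * i < + 108 * j → i < j
  *108-cancel-< i j = ℤ.*-cancelˡ-<-nonNeg {i} {j} (+ 108)

  floor≤ : ∀ i k → i < + 108 * (1ℤ + k) → i / + 108 ≤ k
  floor≤ i k h = <suc⇒≤ q k (*108-cancel-< q (1ℤ + k)
    (ℤ.≤-<-trans (subst (_≤ i) (ℤ.*-comm q (+ 108)) ([n/d]*d≤n i (+ 108))) h))
    where q = i / + 108

  ≤floor : ∀ i k → + 108 * k ≤ i → k ≤ i / + 108
  ≤floor i k h = <suc⇒≤ k q (*108-cancel-< k (1ℤ + q) (ℤ.≤-<-trans h
    (subst (i <_) (trans (cong (λ p → (1ℤ + p) * + 108) (sym (div-pos-is-/ℕ i 108))) (ℤ.*-comm (1ℤ + q) (+ 108)))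
      (n<s[n/ℕd]*d i 108))))
    where q = i / + 108

  -- Lagrange's identity relating numerator, imbalance and cost.

  budget : ∀ s r c t₁ t₂ t₃ e₁ e₂ e₃ →
    (+ 2 * s - + 3) * (+ 2 * s - + 3) ≤ + 24 * t₁ + e₁ →
    (+ 2 * r - + 3) * (+ 2 * r - + 3) ≤ + 24 * t₂ + e₂ →
    (+ 2 * c - + 3) * (+ 2 * c - + 3) ≤ + 24 * t₃ + e₃ →
    + 4 * numeratorℤ (+ 4 * s + r + c) + imbalance (+ 3 + s) r c ≤ + 432 * (t₁ + t₂ + t₃) + (+ 18 * (e₁ + e₂ + e₃) + + 80)
  budget s r c t₁ t₂ t₃ e₁ e₂ e₃ h₁ h₂ h₃ =
    -- For `n = 4s + r + c` the identity contains `(4S + R + C)² = (2n - 18)² = 4 * numeratorℤ n -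
    -- 80`, the source of the constant 80; and `432 = 18 * 24`.
    ≤-by (+≥0 18 ⊗ (gap h₁ ⊕ gap h₂ ⊕ gap h₃)) (lagrange s r c t₁ t₂ t₃ e₁ e₂ e₃)
    where
    -- Lagrange's identity for (4, 1, 1) and (2s - 3, 2r - 3, 2c - 3).
    lagrange : ∀ s r c t₁ t₂ t₃ e₁ e₂ e₃ →
      + 432 * (t₁ + t₂ + t₃) + (+ 18 * (e₁ + e₂ + e₃) + + 80)
        - (+ 4 * ((+ 4 * s + r + c) * (+ 4 * s + r + c) - + 18 * (+ 4 * s + r + c) + + 101)
           + ((+ 2 * (+ 3 + s - + 4 * r) + + 3) * (+ 2 * (+ 3 + s - + 4 * r) + + 3)
             + (+ 2 * (+ 3 + s - + 4 * c) + + 3) * (+ 2 * (+ 3 + s - + 4 * c) + + 3)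
             + (+ 2 * (r - c)) * (+ 2 * (r - c))))
      ≡ + 18 * ((+ 24 * t₁ + e₁ - (+ 2 * s - + 3) * (+ 2 * s - + 3))
              + (+ 24 * t₂ + e₂ - (+ 2 * r - + 3) * (+ 2 * r - + 3))
              + (+ 24 * t₃ + e₃ - (+ 2 * c - + 3) * (+ 2 * c - + 3)))
    lagrange = solve-∀

  imbalance-triple : ∀ s r c → imbalance (+ 3 + + 3 * s) (+ 3 * r) (+ 3 * c) ≡ + 9 * imbalance s r c
  imbalance-triple = expand
    where
    expand : ∀ s r c →
        (+ 2 * (+ 3 + + 3 * s - + 4 * (+ 3 * r)) + + 3) * (+ 2 * (+ 3 + + 3 * s - + 4 * (+ 3 * r)) + + 3)
          + (+ 2 * (+ 3 + + 3 * s - + 4 * (+ 3 * c)) + + 3) * (+ 2 * (+ 3 + + 3 * s - + 4 * (+ 3 * c)) + + 3)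
          + (+ 2 * (+ 3 * r - + 3 * c)) * (+ 2 * (+ 3 * r - + 3 * c))
      ≡ + 9 * ((+ 2 * (s - + 4 * r) + + 3) * (+ 2 * (s - + 4 * r) + + 3)
          + (+ 2 * (s - + 4 * c) + + 3) * (+ 2 * (s - + 4 * c) + + 3)
          + (+ 2 * (r - c)) * (+ 2 * (r - c)))
    expand = solve-∀

  order : ℕ → ℕ → ℕ → ℕ
  order s r c = 4 ℕ.* s ℕ.+ r ℕ.+ c

  cost : ℕ → ℕ → ℕ → ℕ
  cost s r c = τ s ℕ.+ τ r ℕ.+ τ c

  -- `422 = 18(1 + 9 + 9) + 80` serves triples with an entry not divisible by 3. When all three are,
  -- the constant is `566 = 18(9 + 9 + 9) + 80`, but the imbalance gains a factor 9.
  data Shape (s r c : ℕ) : Set where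
    generic : + 4 * numerator (order s r c) + imbalance (+ (3 ℕ.+ s)) (+ r) (+ c) ≤ + 432 * + cost s r c + + 422 → Shape s r c
    tripled : ∀ s′ r′ c′ → s ≡ 3 ℕ.* s′ → r ≡ 3 ℕ.* r′ → c ≡ 3 ℕ.* c′ →
              + 4 * numerator (order s r c) + + 9 * imbalance (+ s′) (+ r′) (+ c′) ≤ + 432 * + cost s r c + + 566 → Shape s r c

  budgetℕ : ∀ s r c e₁ e₂ e₃ →
    (+ 2 * + s - + 3) * (+ 2 * + s - + 3) ≤ + 24 * + τ s + e₁ →
    (+ 2 * + r - + 3) * (+ 2 * + r - + 3) ≤ + 24 * + τ r + e₂ →
    (+ 2 * + c - + 3) * (+ 2 * + c - + 3) ≤ + 24 * + τ c + e₃ →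
    + 4 * numerator (order s r c) + imbalance (+ (3 ℕ.+ s)) (+ r) (+ c) ≤ + 432 * + cost s r c + (+ 18 * (e₁ + e₂ + e₃) + + 80)
  budgetℕ s r c e₁ e₂ e₃ h₁ h₂ h₃ =
    subst (λ n → + 4 * numeratorℤ n + imbalance (+ (3 ℕ.+ s)) (+ r) (+ c) ≤ + 432 * + cost s r c + (+ 18 * (e₁ + e₂ + e₃) + + 80))
      (cong (λ x → x + + r + + c) (sym (ℤ.pos-* 4 s)))
      (budget (+ s) (+ r) (+ c) (+ τ s) (+ τ r) (+ τ c) e₁ e₂ e₃ h₁ h₂ h₃)

  shape : ∀ s r c → Shape s r c
  shape s r c with τ-square s | τ-square r | τ-square c
  ... | nontriple h | _ | _ = generic (budgetℕ s r c (+ 1) (+ 9) (+ 9) (ℤ.≤-reflexive h) (τ-below r) (τ-below c))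
  ... | triple _ _ _ | nontriple h | _ = generic (budgetℕ s r c (+ 9) (+ 1) (+ 9) (τ-below s) (ℤ.≤-reflexive h) (τ-below c))
  ... | triple _ _ _ | triple _ _ _ | nontriple h = generic (budgetℕ s r c (+ 9) (+ 9) (+ 1) (τ-below s) (τ-below r) (ℤ.≤-reflexive h))
  ... | triple s′ eq₁ _ | triple r′ eq₂ _ | triple c′ eq₃ _ = tripled s′ r′ c′ eq₁ eq₂ eq₃
    (subst (λ f → + 4 * numerator (order s r c) + f ≤ + 432 * + cost s r c + + 566) ninefold
      (budgetℕ s r c (+ 9) (+ 9) (+ 9) (τ-below s) (τ-below r) (τ-below c)))
    where
    scaled : ∀ m k → m ≡ 3 ℕ.* k → + m ≡ + 3 * + k
    scaled m k eq = trans (cong +_ eq) (ℤ.pos-* 3 k)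
    ninefold : imbalance (+ (3 ℕ.+ s)) (+ r) (+ c) ≡ + 9 * imbalance (+ s′) (+ r′) (+ c′)
    ninefold = trans (cong₂ (λ x y → imbalance (+ 3 + x) y (+ c)) (scaled s s′ eq₁) (scaled r r′ eq₂))
      (trans (cong (imbalance (+ 3 + + 3 * + s′) (+ 3 * + r′)) (scaled c c′ eq₃)) (imbalance-triple (+ s′) (+ r′) (+ c′)))

  -- From the quadratic inequality to the rounded formula.

  data Residue (m : ℕ) : ℤ → Set where
    plus  : m ≡ 36 → Residue m 1ℤ
    minus : Residue m -1ℤ
    plain : m ≢ 30 → m ≢ 42 → Residue m 0ℤ

  ≡ᵇ-true : ∀ {m n} → (m ℕ.≡ᵇ n) ≡ true → m ≡ n
  ≡ᵇ-true {m} {n} eq = ℕ.≡ᵇ⇒≡ m n (subst T (sym eq) _)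

  ≡ᵇ-false : ∀ {m n} → (m ℕ.≡ᵇ n) ≡ false → m ≢ n
  ≡ᵇ-false {m} {n} eq m≡n = subst T eq (ℕ.≡⇒≡ᵇ m n m≡n)

  residue : ∀ m → Residue m (correction m)
  residue m with m ℕ.≡ᵇ 36 in eq₁ | m ℕ.≡ᵇ 30 in eq₂ | m ℕ.≡ᵇ 42 in eq₃
  ... | true  | _     | _     = plus (≡ᵇ-true eq₁)
  ... | false | true  | _     = minus
  ... | false | false | true  = minus
  ... | false | false | false = plain (≡ᵇ-false eq₂) (≡ᵇ-false eq₃)

  -- The floor bound needs `4q < 432(1 + v + k)`, and 428 is the last multiple of 4 below 432.
  floor-bound : ∀ q v k → + 4 * q ≤ + 432 * v + + 428 + + 432 * k → q / + 108 ≤ v + k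
  floor-bound q v k h = floor≤ q (v + k) (ℤ.*-cancelˡ-<-nonNeg {q} {+ 108 * (1ℤ + (v + k))} (+ 4)
    (ℤ.suc[i]≤j⇒i<j (≤-by (+≥0 3 ⊕ gap h) (expand q v k))))
    where
    expand : ∀ q v k → + 4 * (+ 108 * (1ℤ + (v + k))) - (1ℤ + + 4 * q)
                     ≡ + 3 + (+ 432 * v + + 428 + + 432 * k - + 4 * q)
    expand = solve-∀

  -- For n ≡ 36 (mod 54) the integer numerator n is ≡ 101 (mod 108), which makes up for the correction term.
  numerator-36 : ∀ n → n ℕ.% 54 ≡ 36 → ∃ λ k → numerator n ≡ + 108 * k + + 101
  numerator-36 n eq = + 27 * q * q + + 27 * q + + 6 , trans (cong numeratorℤ n-form) (expand q)
    where
    q = + (n ℕ./ 54)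
    n-form : + n ≡ + 36 + q * + 54
    n-form = trans (cong +_ (trans (ℕ.m≡m%n+[m/n]*n n 54) (cong (ℕ._+ n ℕ./ 54 ℕ.* 54) eq)))
      (cong (λ x → + 36 + x) (ℤ.pos-* (n ℕ./ 54) 54))
    expand : ∀ q → (+ 36 + q * + 54) * (+ 36 + q * + 54) - + 18 * (+ 36 + q * + 54) + + 101
                 ≡ + 108 * (+ 27 * q * q + + 27 * q + + 6) + + 101
    expand = solve-∀

  floor-101 : ∀ q k → q ≡ + 108 * k + + 101 → q / + 108 ≤ k
  floor-101 q k refl = floor≤ q k (ℤ.suc[i]≤j⇒i<j (≤-by (+≥0 6) (slack k)))
    where
    slack : ∀ k → + 108 * (1ℤ + k) - (1ℤ + (+ 108 * k + + 101)) ≡ + 6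
    slack = solve-∀

  -- The hypothesis reads `432k + 404 ≤ 432v + 400`, which forces `k < v`; 400 is the last multiple
  -- of 4 below `404 = 4 * 101`.
  quotient-101 : ∀ q k v → q ≡ + 108 * k + + 101 → + 4 * q ≤ + 432 * v + + 400 → k < v
  quotient-101 q k v refl h = ℤ.*-cancelˡ-<-nonNeg {k} {v} (+ 432)
    (ℤ.suc[i]≤j⇒i<j (≤-by (+≥0 3 ⊕ gap h) (expand k v)))
    where
    expand : ∀ k v → + 432 * v - (1ℤ + + 432 * k)
                   ≡ + 3 + (+ 432 * v + + 400 - + 4 * (+ 108 * k + + 101))
    expand = solve-∀

  bound-plus : ∀ n v → n ℕ.% 54 ≡ 36 → + 4 * numerator n ≤ + 432 * v + + 400 → numerator n / + 108 + 1ℤ ≤ v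
  bound-plus n v eq h = from (numerator-36 n eq)
    where
    from : (∃ λ k → numerator n ≡ + 108 * k + + 101) → numerator n / + 108 + 1ℤ ≤ v
    from (k , numerator≡) = ℤ.≤-trans (ℤ.+-monoˡ-≤ 1ℤ (floor-101 (numerator n) k numerator≡))
      (subst (_≤ v) (ℤ.+-comm 1ℤ k) (ℤ.i<j⇒suc[i]≤j (quotient-101 (numerator n) k v numerator≡ h)))

  -- Lets an imbalance `f` pay for lowering the constant 422 or 566 to the target 400, 428 or 860.
  subtract : ∀ {a f b d e} → a + f ≤ b + d → d ≤ f + e → a ≤ b + e
  subtract {a} {f} {b} {d} {e} h₁ h₂ = ≤-by (gap h₁ ⊕ gap h₂) (expand a f b d e)
    where
    expand : ∀ a f b d e → b + e - a ≡ b + d - (a + f) + (f + e - d)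
    expand = solve-∀

  -- Congruences satisfied by nearly proportional triples.

  clash : ∀ d .{{_ : ℕ.NonZero d}} a q m b → a ℕ.+ q ℕ.* d ℕ.+ b ≡ m ℕ.* d → (a ℕ.+ b) ℕ.% d ≡ 0
  clash d a q m b eq = begin
    (a ℕ.+ b) ℕ.% d                 ≡⟨ ℕ.[m+kn]%n≡m%n (a ℕ.+ b) q d ⟨
    (a ℕ.+ b ℕ.+ q ℕ.* d) ℕ.% d     ≡⟨ cong (ℕ._% d) (trans (swap a b (q ℕ.* d)) eq) ⟩
    (m ℕ.* d) ℕ.% d                 ≡⟨ ℕ.m*n%n≡0 m d ⟩
    0                               ∎
    where
    open ≡-Reasoning
    swap : ∀ a b x → a ℕ.+ b ℕ.+ x ≡ a ℕ.+ x ℕ.+ b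
    swap = ℕ-Solver.solve-∀

  order-generic : ∀ s r k → 3 ℕ.+ s ℕ.+ k ≡ 4 ℕ.* r → order s r r ℕ.+ (12 ℕ.+ 4 ℕ.* k) ≡ r ℕ.* 18
  order-generic s r k eq = trans (expand s r k) (trans (cong (λ x → 4 ℕ.* x ℕ.+ 2 ℕ.* r) eq) (collect r))
    where
    expand : ∀ s r k → 4 ℕ.* s ℕ.+ r ℕ.+ r ℕ.+ (12 ℕ.+ 4 ℕ.* k) ≡ 4 ℕ.* (3 ℕ.+ s ℕ.+ k) ℕ.+ 2 ℕ.* r
    expand = ℕ-Solver.solve-∀
    collect : ∀ r → 4 ℕ.* (4 ℕ.* r) ℕ.+ 2 ℕ.* r ≡ r ℕ.* 18
    collect = ℕ-Solver.solve-∀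

  order-tripled : ∀ s r k → s ℕ.+ k ≡ 4 ℕ.* r →
                  order (3 ℕ.* s) (3 ℕ.* r) (3 ℕ.* r) ℕ.+ 12 ℕ.* k ≡ r ℕ.* 54
  order-tripled s r k eq = trans (expand s r k) (trans (cong (λ x → 12 ℕ.* x ℕ.+ 6 ℕ.* r) eq) (collect r))
    where
    expand : ∀ s r k → 4 ℕ.* (3 ℕ.* s) ℕ.+ 3 ℕ.* r ℕ.+ 3 ℕ.* r ℕ.+ 12 ℕ.* k ≡ 12 ℕ.* (s ℕ.+ k) ℕ.+ 6 ℕ.* r
    expand = ℕ-Solver.solve-∀
    collect : ∀ r → 12 ℕ.* (4 ℕ.* r) ℕ.+ 6 ℕ.* r ≡ r ℕ.* 54
    collect = ℕ-Solver.solve-∀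

  split-36 : ∀ n b m → n ℕ.% 54 ≡ 36 → n ℕ.+ b ≡ m → 36 ℕ.+ n ℕ./ 54 ℕ.* 54 ℕ.+ b ≡ m
  split-36 n b m eq eq′ = trans (cong (ℕ._+ b) (trans (cong (ℕ._+ n ℕ./ 54 ℕ.* 54) (sym eq)) (sym (ℕ.m≡m%n+[m/n]*n n 54)))) eq′

  -- Proportionality gives `n + 12 + 4k = 18r`, while `n ≡ 36` makes `n` a multiple of 18; but
  -- `12 + 4k` is not one for `k < 4`.
  no-generic : ∀ s r k → k ℕ.< 4 → order s r r ℕ.% 54 ≡ 36 → 3 ℕ.+ s ℕ.+ k ≡ 4 ℕ.* r → ⊥
  no-generic s r k k<4 n≡36 eq = check k k<4 (clash 18 36 (3 ℕ.* q) r (12 ℕ.+ 4 ℕ.* k)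
    (trans (cong (λ x → 36 ℕ.+ x ℕ.+ (12 ℕ.+ 4 ℕ.* k)) (regroup q))
           (split-36 n (12 ℕ.+ 4 ℕ.* k) _ n≡36 (order-generic s r k eq))))
    where
    n = order s r r
    q = n ℕ./ 54
    regroup : ∀ q → 3 ℕ.* q ℕ.* 18 ≡ q ℕ.* 54
    regroup = ℕ-Solver.solve-∀
    check : ∀ k → k ℕ.< 4 → (36 ℕ.+ (12 ℕ.+ 4 ℕ.* k)) ℕ.% 18 ≢ 0
    check 0 _ ()
    check 1 _ ()
    check 2 _ ()
    check 3 _ ()
    check (suc (suc (suc (suc k)))) (s≤s (s≤s (s≤s (s≤s ())))) _

  -- From `n + 12k = 54r` the number `36 + 12k` would be a multiple of 54, which fails for `k < 4`.
  no-tripled : ∀ s r k → k ℕ.< 4 → order (3 ℕ.* s) (3 ℕ.* r) (3 ℕ.* r) ℕ.% 54 ≡ 36 → s ℕ.+ k ≡ 4 ℕ.* r → ⊥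
  no-tripled s r k k<4 n≡36 eq =
    check k k<4 (clash 54 36 (n ℕ./ 54) r (12 ℕ.* k) (split-36 n (12 ℕ.* k) _ n≡36 (order-tripled s r k eq)))
    where
    n = order (3 ℕ.* s) (3 ℕ.* r) (3 ℕ.* r)
    check : ∀ k → k ℕ.< 4 → (36 ℕ.+ 12 ℕ.* k) ℕ.% 54 ≢ 0
    check 0 _ ()
    check 1 _ ()
    check 2 _ ()
    check 3 _ ()
    check (suc (suc (suc (suc k)))) (s≤s (s≤s (s≤s (s≤s ())))) _

  complement-mod : ∀ d .{{_ : ℕ.NonZero d}} a b m n → n ℕ.+ a ≡ m ℕ.* d → a ℕ.+ b ≡ d → b ℕ.< d → 0 ℕ.< a → n ℕ.% d ≡ b
  complement-mod d a b zero    n eq _ _ 0<a = ⊥-elim (ℕ.<⇒≱ 0<a (ℕ.≤-trans (ℕ.m≤n+m a n) (ℕ.≤-reflexive eq)))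
  complement-mod d a b (suc m) n eq a+b≡d b<d _ = begin
    n ℕ.% d                  ≡⟨ cong (ℕ._% d) n≡ ⟩
    (b ℕ.+ m ℕ.* d) ℕ.% d    ≡⟨ ℕ.[m+kn]%n≡m%n b m d ⟩
    b ℕ.% d                  ≡⟨ ℕ.m<n⇒m%n≡m b<d ⟩
    b                        ∎
    where
    open ≡-Reasoning
    swap : ∀ a b x → a ℕ.+ b ℕ.+ x ≡ b ℕ.+ x ℕ.+ a
    swap = ℕ-Solver.solve-∀
    n≡ : n ≡ b ℕ.+ m ℕ.* d
    n≡ = ℕ.+-cancelʳ-≡ a n _ (trans eq (trans (cong (ℕ._+ m ℕ.* d) (sym a+b≡d)) (swap a b (m ℕ.* d))))

  -- The closest triples, `k = 1` and `k = 2`, put `n` in the classes `-12` and `-24` modulo 54,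
  -- that is 42 and 30, exactly those with correction -1.
  tripled-1 : ∀ s r → s ℕ.+ 1 ≡ 4 ℕ.* r → order (3 ℕ.* s) (3 ℕ.* r) (3 ℕ.* r) ℕ.% 54 ≡ 42
  tripled-1 s r eq = complement-mod 54 12 42 r _ (order-tripled s r 1 eq) refl (from-yes (42 ℕ.<? 54)) z<s

  tripled-2 : ∀ s r → s ℕ.+ 2 ≡ 4 ℕ.* r → order (3 ℕ.* s) (3 ℕ.* r) (3 ℕ.* r) ℕ.% 54 ≡ 30
  tripled-2 s r eq = complement-mod 54 24 30 r _ (order-tripled s r 2 eq) refl (from-yes (30 ℕ.<? 54)) z<s

  nine-36 : ∀ {f} → + 36 ≤ f → + 566 ≤ + 9 * f + + 400
  nine-36 {f} h = ℤ.≤-trans (from-yes (+ 566 ≤? + 724)) (ℤ.+-monoˡ-≤ (+ 400) (ℤ.*-monoˡ-≤-nonNeg (+ 9) h))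

  nine-18 : ∀ {f} → + 18 ≤ f → + 566 ≤ + 9 * f + + 428
  nine-18 {f} h = ℤ.≤-trans (from-yes (+ 566 ≤? + 590)) (ℤ.+-monoˡ-≤ (+ 428) (ℤ.*-monoˡ-≤-nonNeg (+ 9) h))

  middle<4 : ∀ {k} → k ≡ 0 ⊎ k ≡ 3 → k ℕ.< 4
  middle<4 (inj₁ refl) = from-yes (0 ℕ.<? 4)
  middle<4 (inj₂ refl) = from-yes (3 ℕ.<? 4)

  close<4 : ∀ {k} → k ≡ 1 ⊎ k ≡ 2 → k ℕ.< 4
  close<4 (inj₁ refl) = from-yes (1 ℕ.<? 4)
  close<4 (inj₂ refl) = from-yes (2 ℕ.<? 4)

  bound-zero : ∀ n v → + 4 * numerator n ≤ + 432 * v + + 428 → numerator n / + 108 + 0ℤ ≤ v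
  bound-zero n v h = subst₂ _≤_ (sym (ℤ.+-identityʳ _)) (ℤ.+-identityʳ v)
    (floor-bound (numerator n) v 0ℤ (subst (+ 4 * numerator n ≤_) (sym (ℤ.+-identityʳ _)) h))

  bound-minus : ∀ n v → + 4 * numerator n ≤ + 432 * v + + 860 → numerator n / + 108 + -1ℤ ≤ v
  bound-minus n v h = subst (numerator n / + 108 + -1ℤ ≤_) (cancel v) (ℤ.+-monoˡ-≤ -1ℤ
    (floor-bound (numerator n) v 1ℤ (subst (+ 4 * numerator n ≤_) (sym (ℤ.+-assoc (+ 432 * v) (+ 428) (+ 432))) h)))
    where
    cancel : ∀ v → v + 1ℤ + -1ℤ ≡ v
    cancel = solve-∀

  -- Corrections 1, 0 and -1 allow the constants 400, 428 and `860 = 428 + 432`. Both 422 and 566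
  -- fit under 860, and 422 under 428. In the other cases the imbalance covers the excess, or the
  -- congruence of `n` rules out the triple.
  cost-bound : ∀ s r c → formula (order s r c) ≤ + cost s r c
  cost-bound s r c = by-cases (residue (n ℕ.% 54)) (shape s r c)
    where
    n = order s r c
    v = + cost s r c
    by-cases : ∀ {d} → Residue (n ℕ.% 54) d → Shape s r c → numerator n / + 108 + d ≤ v
    by-cases (plus n≡36) (generic h) = bound-plus n v n≡36 (subtract {b = + 432 * v} h (enough (near (3 ℕ.+ s) r c)))
      where
      enough : Near (3 ℕ.+ s) r c → + 422 ≤ imbalance (+ (3 ℕ.+ s)) (+ r) (+ c) + + 400
      enough (far f) = ℤ.≤-trans (from-yes (+ 422 ≤? + 436)) (ℤ.+-monoˡ-≤ (+ 400) f)
      enough (middle k k∈ refl eq _) = ⊥-elim (no-generic s r k (middle<4 k∈) n≡36 eq)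
      enough (close k k∈ refl eq)    = ⊥-elim (no-generic s r k (close<4 k∈) n≡36 eq)
    by-cases (plus n≡36) (tripled s′ r′ c′ refl refl refl h) =
      bound-plus n v n≡36 (subtract {b = + 432 * v} h (enough (near s′ r′ c′)))
      where
      enough : Near s′ r′ c′ → + 566 ≤ + 9 * imbalance (+ s′) (+ r′) (+ c′) + + 400
      enough (far f) = nine-36 f
      -- Here `9 * 18 = 162` just misses the required `566 - 400 = 166`, so the congruence is used
      -- for `middle` as well as for `close`.
      enough (middle k k∈ refl eq _) = ⊥-elim (no-tripled s′ r′ k (middle<4 k∈) n≡36 eq)
      enough (close k k∈ refl eq)    = ⊥-elim (no-tripled s′ r′ k (close<4 k∈) n≡36 eq)
    by-cases minus (generic h) = bound-minus n v (subtract {b = + 432 * v} h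
      (ℤ.≤-trans (from-yes (+ 422 ≤? + 860)) (ℤ.+-monoˡ-≤ (+ 860) (imbalance≥0 (+ (3 ℕ.+ s)) (+ r) (+ c)))))
    by-cases minus (tripled s′ r′ c′ refl refl refl h) = bound-minus n v (subtract {b = + 432 * v} h
      (ℤ.≤-trans (from-yes (+ 566 ≤? + 860)) (ℤ.+-monoˡ-≤ (+ 860) (+≥0 9 ⊗ imbalance≥0 (+ s′) (+ r′) (+ c′)))))
    by-cases (plain _ _) (generic h) = bound-zero n v (subtract {b = + 432 * v} h
      (ℤ.≤-trans (from-yes (+ 422 ≤? + 428)) (ℤ.+-monoˡ-≤ (+ 428) (imbalance≥0 (+ (3 ℕ.+ s)) (+ r) (+ c)))))
    by-cases (plain n≢30 n≢42) (tripled s′ r′ c′ refl refl refl h) =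
      bound-zero n v (subtract {b = + 432 * v} h (enough (near s′ r′ c′)))
      where
      enough : Near s′ r′ c′ → + 566 ≤ + 9 * imbalance (+ s′) (+ r′) (+ c′) + + 428
      enough (far f) = ℤ.≤-trans (nine-36 f) (ℤ.+-monoʳ-≤ (+ 9 * imbalance (+ s′) (+ r′) (+ c′)) (from-yes (+ 400 ≤? + 428)))
      enough (middle _ _ _ _ f) = nine-18 f
      enough (close _ (inj₁ refl) refl eq) = ⊥-elim (n≢42 (tripled-1 s′ r′ eq))
      enough (close _ (inj₂ refl) refl eq) = ⊥-elim (n≢30 (tripled-2 s′ r′ eq))

  -- Lowering the order without raising the cost.

  τ-step-≤ : ∀ m → τ m ℕ.≤ τ (suc m)
  τ-step-≤ 0 = z≤n
  τ-step-≤ 1 = z≤n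
  τ-step-≤ 2 = z≤n
  τ-step-≤ (suc (suc (suc m))) = ℕ.+-mono-≤ (ℕ.n≤1+n m) (τ-step-≤ m)

  Cheaper : ℕ → ℕ → Set
  Cheaper n v = ∃ λ s → ∃ λ r → ∃ λ c → order s r c ≡ n × cost s r c ℕ.≤ v

  -- Shorten `r`, or else `c`. If both are 0, trading one unit of `s` for `r = 3` lowers the order
  -- by `4 - 3`, and `τ 3 = 0`.
  decrease : ∀ n s r c → order s r c ≡ suc n → Cheaper n (cost s r c)
  decrease n s (suc r) c eq = s , r , c
    , ℕ.suc-injective (trans (expand s r c) eq)
    , ℕ.+-monoˡ-≤ (τ c) (ℕ.+-monoʳ-≤ (τ s) (τ-step-≤ r))
    where
    expand : ∀ s r c → suc (4 ℕ.* s ℕ.+ r ℕ.+ c) ≡ 4 ℕ.* s ℕ.+ suc r ℕ.+ c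
    expand = ℕ-Solver.solve-∀
  decrease n s zero (suc c) eq = s , 0 , c
    , ℕ.suc-injective (trans (expand s c) eq)
    , ℕ.+-monoʳ-≤ (τ s ℕ.+ 0) (τ-step-≤ c)
    where
    expand : ∀ s c → suc (4 ℕ.* s ℕ.+ 0 ℕ.+ c) ≡ 4 ℕ.* s ℕ.+ 0 ℕ.+ suc c
    expand = ℕ-Solver.solve-∀
  decrease n (suc s) zero zero eq = s , 3 , 0
    , ℕ.suc-injective (trans (expand s) eq)
    , ℕ.+-monoˡ-≤ 0 (ℕ.+-monoˡ-≤ 0 (τ-step-≤ s))
    where
    expand : ∀ s → suc (4 ℕ.* s ℕ.+ 3 ℕ.+ 0) ≡ 4 ℕ.* suc s ℕ.+ 0 ℕ.+ 0
    expand = ℕ-Solver.solve-∀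

  decrease-by : ∀ k n s r c → order s r c ≡ k ℕ.+ n → Cheaper n (cost s r c)
  decrease-by zero    n s r c eq = s , r , c , eq , ℕ.≤-refl
  decrease-by (suc k) n s r c eq with decrease (k ℕ.+ n) s r c eq
  ... | s′ , r′ , c′ , eq′ , le′ with decrease-by k n s′ r′ c′ eq′
  ... | s″ , r″ , c″ , eq″ , le″ = s″ , r″ , c″ , eq″ , ℕ.≤-trans le″ le′

  -- Handles comparison triples whose order exceeds `n` because `q ∸ 3 * s` or `r ∸ 3 * t` is
  -- truncated.
  cost-bound-≤ : ∀ n s r c → n ℕ.≤ order s r c → formula n ≤ + cost s r c
  cost-bound-≤ n s r c n≤ with decrease-by (order s r c ℕ.∸ n) n s r c (sym (ℕ.m∸n+n≡m n≤))
  ... | s′ , r′ , c′ , refl , le = ℤ.≤-trans (cost-bound s′ r′ c′) (+≤+ le)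

  -- r ≤ c keeps the y of every monochromatic triple out of the last red block.
  Optimal : ℕ → Set
  Optimal n = ∃ λ s → ∃ λ r → ∃ λ c → 1 ℕ.≤ s × r ℕ.≤ c × order s r c ≡ n × + cost s r c ≤ formula n

  -- Optimal triples for every `n ≥ 4`, by period 54.

  correction-periodic : ∀ n → correction ((54 ℕ.+ n) ℕ.% 54) ≡ correction (n ℕ.% 54)
  correction-periodic n = cong correction (trans (cong (ℕ._% 54) (ℕ.+-comm 54 n)) (ℕ.[m+n]%n≡m%n n 54))

  -- `numerator (54 + n)` is `numerator n + 108(n + 18)`, so the floor gains at least `n + 18` while
  -- the correction is periodic.
  formula-shift : ∀ n → formula n + + (n ℕ.+ 18) ≤ formula (54 ℕ.+ n)
  formula-shift n = subst (formula n + + (n ℕ.+ 18) ≤_) (cong (λ d → numerator (54 ℕ.+ n) / + 108 + d) (sym (correction-periodic n)))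
    (subst (_≤ numerator (54 ℕ.+ n) / + 108 + correction (n ℕ.% 54)) (swap (numerator n / + 108) (+ (n ℕ.+ 18)) (correction (n ℕ.% 54))) (ℤ.+-monoˡ-≤ (correction (n ℕ.% 54))
      (≤floor (numerator (54 ℕ.+ n)) (numerator n / + 108 + + (n ℕ.+ 18)) (≤-by
        (gap (subst (_≤ numerator n) (ℤ.*-comm (numerator n / + 108) (+ 108)) ([n/d]*d≤n (numerator n) (+ 108))))
        (expand (+ n) (numerator n / + 108))))))
    where
    swap : ∀ a b d → a + b + d ≡ a + d + b
    swap = solve-∀
    expand : ∀ n q → ((+ 54 + n) * (+ 54 + n) - + 18 * (+ 54 + n) + + 101) - + 108 * (q + (n + + 18))
                   ≡ (n * n - + 18 * n + + 101) - + 108 * q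
    expand = solve-∀

  -- `τ (12 + s)` exceeds `τ s` by `4s + 18`, and the other two shifts add `r` and `c`. The total is
  -- `n + 18`, the growth provided by `formula-shift`.
  optimal-shift : ∀ n → Optimal n → Optimal (54 ℕ.+ n)
  optimal-shift n (s , r , c , 1≤s , r≤c , refl , le) =
    12 ℕ.+ s , 3 ℕ.+ r , 3 ℕ.+ c , s≤s z≤n , ℕ.+-monoʳ-≤ 3 r≤c , order-shift s r c
    , ℤ.≤-trans (ℤ.≤-reflexive (cong +_ (cost-shift s r c (τ s) (τ r) (τ c))))
        (ℤ.≤-trans (ℤ.+-monoˡ-≤ (+ (order s r c ℕ.+ 18)) le) (formula-shift (order s r c)))
    where
    order-shift : ∀ s r c → 4 ℕ.* (12 ℕ.+ s) ℕ.+ (3 ℕ.+ r) ℕ.+ (3 ℕ.+ c) ≡ 54 ℕ.+ (4 ℕ.* s ℕ.+ r ℕ.+ c)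
    order-shift = ℕ-Solver.solve-∀
    cost-shift : ∀ s r c x y z →
      (9 ℕ.+ s) ℕ.+ ((6 ℕ.+ s) ℕ.+ ((3 ℕ.+ s) ℕ.+ (s ℕ.+ x))) ℕ.+ (r ℕ.+ y) ℕ.+ (c ℕ.+ z)
      ≡ x ℕ.+ y ℕ.+ z ℕ.+ (4 ℕ.* s ℕ.+ r ℕ.+ c ℕ.+ 18)
    cost-shift = ℕ-Solver.solve-∀

  -- What `s` leaves is halved, with the smaller half as `r` so that `r ≤ c`. If `4s > n`, the order
  -- condition in `Balanced` rejects `s`.
  balanced : ℕ → ℕ → ℕ × ℕ
  balanced n s = w ℕ./ 2 , w ℕ.∸ w ℕ./ 2
    where w = n ℕ.∸ 4 ℕ.* s

  Balanced : ℕ → ℕ → Set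
  Balanced n s = r ℕ.≤ c × order s r c ≡ n × + cost s r c ≤ formula n
    where
    r = proj₁ (balanced n s)
    c = proj₂ (balanced n s)

  balanced? : ∀ n s → Dec (Balanced n s)
  balanced? n s = (_ ℕ.≤? _) ×-dec (_ ℕ.≟ n) ×-dec (_ ≤? formula n)

  -- One full period, `n = 4` to `57`, checked by evaluation. Since `4s ≤ n`, no `s` beyond 14 can
  -- occur.
  optimal-base : ∀ (i : Fin 54) → ∃ λ (j : Fin 14) → Balanced (4 ℕ.+ toℕ i) (suc (toℕ j))
  optimal-base = from-yes (all? {n = 54} {P = λ i → ∃ λ (j : Fin 14) → Balanced (4 ℕ.+ toℕ i) (suc (toℕ j))}
    λ i → any? λ j → balanced? (4 ℕ.+ toℕ i) (suc (toℕ j)))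

  balanced-optimal : ∀ n → (∃ λ (j : Fin 14) → Balanced n (suc (toℕ j))) → Optimal n
  balanced-optimal n (j , r≤c , eq , le) = suc (toℕ j)
    , proj₁ (balanced n (suc (toℕ j))) , proj₂ (balanced n (suc (toℕ j))) , s≤s z≤n , r≤c , eq , le

  optimal-small : ∀ i → i ℕ.< 54 → Optimal (4 ℕ.+ i)
  optimal-small i i<54 = subst (λ i → Optimal (4 ℕ.+ i)) (toℕ-fromℕ< i<54)
    (balanced-optimal (4 ℕ.+ toℕ (fromℕ< i<54)) (optimal-base (fromℕ< i<54)))

  optimal-shifts : ∀ k n → Optimal n → Optimal (k ℕ.* 54 ℕ.+ n)
  optimal-shifts zero    n o = o
  optimal-shifts (suc k) n o =
    subst Optimal (sym (ℕ.+-assoc 54 (k ℕ.* 54) n)) (optimal-shift (k ℕ.* 54 ℕ.+ n) (optimal-shifts k n o))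

  optimal : ∀ n → Optimal (4 ℕ.+ n)
  optimal n = subst Optimal (trans (swap (n ℕ./ 54 ℕ.* 54) (n ℕ.% 54)) (cong (4 ℕ.+_) (sym (ℕ.m≡m%n+[m/n]*n n 54))))
    (optimal-shifts (n ℕ./ 54) (4 ℕ.+ n ℕ.% 54) (optimal-small (n ℕ.% 54) (ℕ.m%n<n n 54)))
    where
    swap : ∀ a b → a ℕ.+ (4 ℕ.+ b) ≡ 4 ℕ.+ (b ℕ.+ a)
    swap = ℕ-Solver.solve-∀

  -- Estimates for colourings with a long last red block.

  correction≤1 : ∀ {m d} → Residue m d → d ≤ 1ℤ
  correction≤1 (plus _)    = ℤ.≤-refl
  correction≤1 minus       = from-yes (-1ℤ ≤? 1ℤ)
  correction≤1 (plain _ _) = from-yes (0ℤ ≤? 1ℤ)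

  -- A numerator strictly below `108v` has floor at most `v - 1`, leaving room for a correction of
  -- 1.
  formula-≤ : ∀ n v → 1ℤ + numerator n ≤ + 108 * v → formula n ≤ v
  formula-≤ n v h = subst (formula n ≤_) (cancel v) (ℤ.+-mono-≤
    (floor≤ (numerator n) (v - 1ℤ) (ℤ.suc[i]≤j⇒i<j (subst (1ℤ + numerator n ≤_) (cong (+ 108 *_) (sym (cancel′ v))) h)))
    (correction≤1 (residue (n ℕ.% 54))))
    where
    cancel : ∀ v → v - 1ℤ + 1ℤ ≡ v
    cancel = solve-∀
    cancel′ : ∀ v → 1ℤ + (v - 1ℤ) ≡ v
    cancel′ = solve-∀

  -- The sum of squares comes from eliminating r by 3r ≤ 4(4s + c) and n by 8 ≤ n ≤ 4s + r + c.
  wide-bound : ∀ s r c n w t₁ t₃ →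
    1ℤ ≤ s → 0ℤ ≤ c → + 3 * s + + 4 ≤ r → + 3 * r ≤ + 4 * (+ 4 * s + c) → + 8 ≤ n → n ≤ + 4 * s + r + c →
    + 2 * (s * r) ≤ + 2 * w + + 3 * (s * (1ℤ + s)) →
    (+ 2 * s - + 3) * (+ 2 * s - + 3) ≤ + 24 * t₁ + + 9 →
    (+ 2 * c - + 3) * (+ 2 * c - + 3) ≤ + 24 * t₃ + + 9 →
    1ℤ + numeratorℤ n ≤ + 108 * (t₁ + w + t₃)
  wide-bound s r c n w t₁ t₃ 1≤s 0≤c ρ≥0 h≥0 8≤n d≥0 hw h₁ h₃ = ℤ.*-cancelˡ-≤-pos _ _ (+ 18) (≤-by
    (+≥0 972 ⊗ gap hw ⊕ +≥0 81 ⊗ gap h₁ ⊕ +≥0 81 ⊗ gap h₃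
      ⊕ +≥0 2 ⊗ (square (+ 10 * c - + 20 - + 10 * (s - 1ℤ)) ⊕ +≥0 13 ⊗ square (c - + 3) ⊕ +≥0 6 ⊗ 0≤c
        ⊕ +≥0 4 ⊗ gap 1≤s ⊗ 0≤c ⊕ +≥0 1079 ⊗ square (s - 1ℤ) ⊕ +≥0 4532 ⊗ gap 1≤s ⊕ +≥0 2813
        ⊕ +≥0 825 ⊗ 0≤s ⊗ gap ρ≥0 ⊕ +≥0 126 ⊗ gap ρ≥0 ⊕ (+≥0 3 ⊗ gap ρ≥0 ⊕ +≥0 10 ⊗ 0≤c) ⊗ gap h≥0)
      ⊕ +≥0 18 ⊗ (square (+ 4 * s + r + c - n - 1ℤ) ⊕ +≥0 2 ⊗ gap d≥0 ⊗ gap 8≤n))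
    (expand s r c n w t₁ t₃))
    where
    0≤s = ℤ.≤-trans (from-yes (0ℤ ≤? 1ℤ)) 1≤s
    expand : ∀ s r c n w t₁ t₃ →
      + 18 * (+ 108 * (t₁ + w + t₃)) - + 18 * (1ℤ + (n * n - + 18 * n + + 101))
      ≡ + 972 * (+ 2 * w + + 3 * (s * (1ℤ + s)) - + 2 * (s * r))
        + + 81 * (+ 24 * t₁ + + 9 - (+ 2 * s - + 3) * (+ 2 * s - + 3))
        + + 81 * (+ 24 * t₃ + + 9 - (+ 2 * c - + 3) * (+ 2 * c - + 3))
        + + 2 * ((+ 10 * c - + 20 - + 10 * (s - 1ℤ)) * (+ 10 * c - + 20 - + 10 * (s - 1ℤ))
          + + 13 * ((c - + 3) * (c - + 3)) + + 6 * c
          + + 4 * (s - 1ℤ) * c + + 1079 * ((s - 1ℤ) * (s - 1ℤ)) + + 4532 * (s - 1ℤ) + + 2813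
          + + 825 * s * (r - (+ 3 * s + + 4)) + + 126 * (r - (+ 3 * s + + 4))
          + (+ 3 * (r - (+ 3 * s + + 4)) + + 10 * c) * (+ 4 * (+ 4 * s + c) - + 3 * r))
        + + 18 * ((+ 4 * s + r + c - n - 1ℤ) * (+ 4 * s + r + c - n - 1ℤ)
          + + 2 * (+ 4 * s + r + c - n) * (n - + 8))
    expand = solve-∀

  -- Here `w`, `t₀`, `t₁`, `t₃` stand for `σ s r`, `τ t`, `τ s`, `τ c`. To leading order `3r > 4t`
  -- gives `24w ≥ 32st - 36s²`. Adding `24t₁ ≈ 4s²` beats `24(t₀ - t₃) ≈ 64s² + 32sc` by `32s²`.
  long-bound-large : ∀ s r c t w t₀ t₁ t₃ →
    1ℤ ≤ s → t ≡ + 4 * s + c → 1ℤ + + 4 * t ≤ + 3 * r →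
    + 2 * (s * r) ≤ + 2 * w + + 3 * (s * (1ℤ + s)) →
    + 24 * t₀ + 1ℤ ≤ (+ 2 * t - + 3) * (+ 2 * t - + 3) →
    (+ 2 * s - + 3) * (+ 2 * s - + 3) ≤ + 24 * t₁ + + 9 →
    (+ 2 * c - + 3) * (+ 2 * c - + 3) ≤ + 24 * t₃ + + 9 →
    t₀ ≤ t₁ + w + t₃
  long-bound-large s r c _ w t₀ t₁ t₃ 1≤s refl hr hw h₀ h₁ h₃ = ℤ.*-cancelˡ-≤-pos _ _ (+ 24) (≤-by
    (gap h₁ ⊕ +≥0 12 ⊗ gap hw ⊕ gap h₃ ⊕ gap h₀
      ⊕ +≥0 4 ⊗ (+≥0 8 ⊗ square s ⊕ +≥0 2 ⊗ gap 1≤s) ⊕ +≥0 8 ⊗ 0≤s ⊗ gap hr)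
    (expand s r c w t₀ t₁ t₃))
    where
    0≤s = ℤ.≤-trans (from-yes (0ℤ ≤? 1ℤ)) 1≤s
    expand : ∀ s r c w t₀ t₁ t₃ →
      + 24 * (t₁ + w + t₃) - + 24 * t₀
      ≡ + 24 * t₁ + + 9 - (+ 2 * s - + 3) * (+ 2 * s - + 3)
        + + 12 * (+ 2 * w + + 3 * (s * (1ℤ + s)) - + 2 * (s * r))
        + (+ 24 * t₃ + + 9 - (+ 2 * c - + 3) * (+ 2 * c - + 3))
        + ((+ 2 * (+ 4 * s + c) - + 3) * (+ 2 * (+ 4 * s + c) - + 3) - (+ 24 * t₀ + 1ℤ))
        + + 4 * (+ 8 * (s * s) + + 2 * (s - 1ℤ))
        + + 8 * s * (+ 3 * r - (1ℤ + + 4 * (+ 4 * s + c)))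
    expand = solve-∀

  -- Half of the main term `24sr` is bounded by `r ≥ 3s + 4`, the other half by `3r > 4t`. To
  -- leading order `4s² + 16st` remains, and `16st ≥ 4t²` because `t ≤ 4s`.
  long-bound-small : ∀ s r t w t₀ t₁ →
    1ℤ ≤ s → s ≤ t → t ≤ + 4 * s → + 3 * s + + 4 ≤ r → 1ℤ + + 4 * t ≤ + 3 * r →
    + 2 * (s * r) ≤ + 2 * w + + 3 * (s * (1ℤ + s)) →
    + 24 * t₀ + 1ℤ ≤ (+ 2 * t - + 3) * (+ 2 * t - + 3) →
    (+ 2 * s - + 3) * (+ 2 * s - + 3) ≤ + 24 * t₁ + + 9 →
    t₀ ≤ t₁ + w
  long-bound-small s r t w t₀ t₁ 1≤s s≤t t≤4s hρ hr hw h₀ h₁ = ℤ.*-cancelˡ-≤-pos _ _ (+ 24) (≤-by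
    (gap h₁ ⊕ +≥0 12 ⊗ gap hw ⊕ gap h₀
      ⊕ +≥0 4 ⊗ (+≥0 3 ⊗ 0≤s ⊗ gap hρ ⊕ 0≤s ⊗ gap hr ⊕ square s ⊕ gap 1≤s
        ⊕ 0≤t ⊗ gap t≤4s ⊕ +≥0 3 ⊗ gap s≤t ⊕ +≥0 3 ⊗ gap 1≤s ⊕ +≥0 2))
    (expand s r t w t₀ t₁))
    where
    0≤s = ℤ.≤-trans (from-yes (0ℤ ≤? 1ℤ)) 1≤s
    0≤t = ℤ.≤-trans 0≤s s≤t
    expand : ∀ s r t w t₀ t₁ →
      + 24 * (t₁ + w) - + 24 * t₀
      ≡ + 24 * t₁ + + 9 - (+ 2 * s - + 3) * (+ 2 * s - + 3)
        + + 12 * (+ 2 * w + + 3 * (s * (1ℤ + s)) - + 2 * (s * r))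
        + ((+ 2 * t - + 3) * (+ 2 * t - + 3) - (+ 24 * t₀ + 1ℤ))
        + + 4 * (+ 3 * s * (r - (+ 3 * s + + 4)) + s * (+ 3 * r - (1ℤ + + 4 * t)) + s * s + (s - 1ℤ)
          + t * (+ 4 * s - t) + + 3 * (t - s) + + 3 * (s - 1ℤ) + + 2)
    expand = solve-∀

  σ-lowerℤ : ∀ s r → + 2 * (+ s * + r) ≤ + 2 * + σ s r + + 3 * (+ s * (1ℤ + + s))
  σ-lowerℤ s r = subst₂ _≤_
    (trans (ℤ.pos-* 2 (s ℕ.* r)) (cong (+ 2 *_) (ℤ.pos-* s r)))
    (cong₂ _+_ (ℤ.pos-* 2 (σ s r)) (trans (ℤ.pos-* 3 (s ℕ.* suc s)) (cong (+ 3 *_) (ℤ.pos-* s (suc s)))))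
    (+≤+ (σ-lower s r))

  -- The lower bound, by the length of the last red block.

  module Regimes (s q r : ℕ) (1≤s : 1 ℕ.≤ s) where

    t = s ℕ.+ q
    n = s ℕ.+ q ℕ.+ r
    c = q ℕ.∸ 3 ℕ.* s

    t≤4s+c : t ℕ.≤ 4 ℕ.* s ℕ.+ c
    t≤4s+c = ℕ.≤-trans (ℕ.+-monoʳ-≤ s (ℕ.m≤n+m∸n q (3 ℕ.* s))) (ℕ.≤-reflexive (sym (ℕ.+-assoc s (3 ℕ.* s) c)))

    n≤order : n ℕ.≤ order s r c
    n≤order = ℕ.≤-trans (ℕ.+-monoˡ-≤ r t≤4s+c) (ℕ.≤-reflexive (swap (4 ℕ.* s) c r))
      where
      swap : ∀ a b c → a ℕ.+ b ℕ.+ c ≡ a ℕ.+ c ℕ.+ b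
      swap = ℕ-Solver.solve-∀

    narrow : r ℕ.≤ 3 ℕ.+ 3 ℕ.* s → formula n ≤ + (τ s ℕ.+ σ s r ℕ.+ τ c)
    narrow h = ℤ.≤-trans (cost-bound-≤ n s r c n≤order) (+≤+ (ℕ.+-monoˡ-≤ (τ c) (ℕ.+-monoʳ-≤ (τ s) (τ≤σ s r h))))

    module _ (4+3s≤r : 4 ℕ.+ 3 ℕ.* s ℕ.≤ r) where

      1≤sℤ : 1ℤ ≤ + s
      1≤sℤ = +≤+ 1≤s

      wideℤ : + 3 * + s + + 4 ≤ + r
      wideℤ = subst (_≤ + r) (trans (ℤ.+-comm (+ 4) (+ (3 ℕ.* s))) (cong (_+ + 4) (ℤ.pos-* 3 s))) (+≤+ 4+3s≤r)

      4s+c : + (4 ℕ.* s ℕ.+ c) ≡ + 4 * + s + + c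
      4s+c = cong (_+ + c) (ℤ.pos-* 4 s)

      wide : 3 ℕ.* r ℕ.≤ 4 ℕ.* t → formula n ≤ + (τ s ℕ.+ σ s r ℕ.+ τ c)
      wide 3r≤4t = formula-≤ n _ (wide-bound (+ s) (+ r) (+ c) (+ n) (+ σ s r) (+ τ s) (+ τ c)
        1≤sℤ (+≥0 c) wideℤ
        (subst₂ _≤_ (ℤ.pos-* 3 r) (trans (ℤ.pos-* 4 (4 ℕ.* s ℕ.+ c)) (cong (+ 4 *_) 4s+c))
          (+≤+ (ℕ.≤-trans 3r≤4t (ℕ.*-monoʳ-≤ 4 t≤4s+c))))
        -- The bound `8 ≤ n` is `1 + 7`: `s ≥ 1` gives `t ≥ 1` and `r ≥ 4 + 3 = 7`.
        (+≤+ (ℕ.+-mono-≤ (ℕ.≤-trans 1≤s (ℕ.m≤m+n s q))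
          (ℕ.≤-trans (ℕ.+-monoʳ-≤ 4 (ℕ.*-monoʳ-≤ 3 1≤s)) 4+3s≤r)))
        (subst (+ n ≤_) (cong (λ x → x + + r + + c) (ℤ.pos-* 4 s)) (+≤+ n≤order))
        (σ-lowerℤ s r) (τ-below s) (τ-below c))

      longℤ : 1 ℕ.+ 4 ℕ.* t ℕ.≤ 3 ℕ.* r → 1ℤ + + 4 * + t ≤ + 3 * + r
      longℤ h = subst₂ _≤_ (cong (λ x → 1ℤ + x) (ℤ.pos-* 4 t)) (ℤ.pos-* 3 r) (+≤+ h)

      long-τ : 1 ℕ.+ 4 ℕ.* t ℕ.≤ 3 ℕ.* r → τ t ℕ.≤ τ s ℕ.+ σ s r ℕ.+ τ c
      long-τ h with 3 ℕ.* s ℕ.≤? q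
      ... | yes 3s≤q = ℤ.drop‿+≤+ (long-bound-large (+ s) (+ r) (+ c) (+ t) (+ σ s r) (+ τ t) (+ τ s) (+ τ c)
        1≤sℤ (trans (cong +_ t≡) 4s+c) (longℤ h) (σ-lowerℤ s r) (τ-above t) (τ-below s) (τ-below c))
        where
        t≡ : t ≡ 4 ℕ.* s ℕ.+ c
        t≡ = trans (cong (s ℕ.+_) (sym (ℕ.m+[n∸m]≡n 3s≤q))) (sym (ℕ.+-assoc s (3 ℕ.* s) c))
      ... | no 3s≰q = ℕ.≤-trans (ℤ.drop‿+≤+ (long-bound-small (+ s) (+ r) (+ t) (+ σ s r) (+ τ t) (+ τ s)
        1≤sℤ (+≤+ (ℕ.m≤m+n s q)) (subst (+ t ≤_) (ℤ.pos-* 4 s) (+≤+ (ℕ.+-monoʳ-≤ s (ℕ.<⇒≤ (ℕ.≰⇒> 3s≰q)))))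
        wideℤ (longℤ h) (σ-lowerℤ s r) (τ-above t) (τ-below s))) (ℕ.m≤m+n _ (τ c))

      -- The comparison triple is `(t, r ∸ 3 * t, 0)`, whose cost counts the colouring with `[t]`
      -- red and everything after it blue. By `long-τ`, the term `τ t` is at most what the first two
      -- blocks and their interaction with the last one contribute.
      long : 1 ℕ.+ 4 ℕ.* t ℕ.≤ 3 ℕ.* r → formula n ≤ + (τ s ℕ.+ σ s r ℕ.+ τ c ℕ.+ τ (r ℕ.∸ 3 ℕ.* t))
      long h = ℤ.≤-trans (cost-bound-≤ n t (r ℕ.∸ 3 ℕ.* t) 0 n≤)
        (+≤+ (ℕ.≤-trans (ℕ.≤-reflexive (ℕ.+-identityʳ _)) (ℕ.+-monoˡ-≤ (τ (r ℕ.∸ 3 ℕ.* t)) (long-τ h))))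
        where
        regroup : ∀ t x → t ℕ.+ (3 ℕ.* t ℕ.+ x) ≡ 4 ℕ.* t ℕ.+ x ℕ.+ 0
        regroup = ℕ-Solver.solve-∀
        n≤ : n ℕ.≤ order t (r ℕ.∸ 3 ℕ.* t) 0
        n≤ = ℕ.≤-trans (ℕ.+-monoʳ-≤ t (ℕ.m≤n+m∸n r (3 ℕ.* t))) (ℕ.≤-reflexive (regroup t (r ℕ.∸ 3 ℕ.* t)))

    formula≤blocks : formula n ≤ + (τ s ℕ.+ σ s r ℕ.+ τ c ℕ.+ τ (r ℕ.∸ 3 ℕ.* t))
    -- Up to `r = 3 + 3s`, `σ s r` still reaches `τ r`. Beyond that, `wide` applies as long as
    -- `3r ≤ 4t`, and afterwards the comparison in `long` takes over.
    formula≤blocks with r ℕ.≤? 3 ℕ.+ 3 ℕ.* s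
    ... | yes h = ℤ.≤-trans (narrow h) (+≤+ (ℕ.m≤m+n _ _))
    ... | no  h with 3 ℕ.* r ℕ.≤? 4 ℕ.* t
    ...   | yes h′ = ℤ.≤-trans (wide (ℕ.≰⇒> h) h′) (+≤+ (ℕ.m≤m+n _ _))
    ...   | no  h′ = long (ℕ.≰⇒> h) (ℕ.≰⇒> h′)

  formula≤M3nst : ∀ n s t → 1 ℕ.≤ s → s ℕ.≤ t → t ℕ.≤ n → formula n ≤ + M3nst n s t
  formula≤M3nst n s t 1≤s s≤t t≤n = subst₂ (λ n t → formula n ≤ + M3nst n s t) n≡ t≡
    (ℤ.≤-trans (Regimes.formula≤blocks s (t ℕ.∸ s) (n ℕ.∸ t) 1≤s) (+≤+ (Blocks.lower s (t ℕ.∸ s) (n ℕ.∸ t))))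
    where
    t≡ : s ℕ.+ (t ℕ.∸ s) ≡ t
    t≡ = ℕ.m+[n∸m]≡n s≤t
    n≡ : s ℕ.+ (t ℕ.∸ s) ℕ.+ (n ℕ.∸ t) ≡ n
    n≡ = trans (cong (ℕ._+ (n ℕ.∸ t)) t≡) (ℕ.m+[n∸m]≡n t≤n)

  -- Passing to the minimum over all colourings.

  ∈-range⁺ : ∀ {a b k} → a ℕ.≤ k → k ℕ.≤ b → k ∈ range a b
  ∈-range⁺ {a} {b} {k} a≤k k≤b = subst (_∈ range a b) (ℕ.m+[n∸m]≡n a≤k)
    (∈-map⁺ (a ℕ.+_) (∈-upTo⁺ (ℕ.∸-monoˡ-< (s≤s k≤b) a≤k)))

  ∈-range⁻ : ∀ a b {k} → k ∈ range a b → a ℕ.≤ k × k ℕ.≤ b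
  ∈-range⁻ a b k∈ with ∈-map⁻ (a ℕ.+_) k∈
  ... | i , i∈ , refl = ℕ.m≤m+n a i , ℕ.s≤s⁻¹ (ℕ.≤-trans
    (ℕ.≤-reflexive (cong suc (ℕ.+-comm a i))) (m≤a∸b⇒m+b≤a (suc b) a (s≤s z≤n) (∈-upTo⁻ i∈)))

  ∈-allValues⁺ : ∀ n s t → 1 ℕ.≤ s → s ℕ.≤ t → t ℕ.≤ n → M3nst n s t ∈ allValues n
  ∈-allValues⁺ n s t 1≤s s≤t t≤n = ∈-concatMap⁺ (λ s → map (M3nst n s) (range s n))
    (lose (∈-range⁺ 1≤s (ℕ.≤-trans s≤t t≤n)) (∈-map⁺ (M3nst n s) (∈-range⁺ s≤t t≤n)))

  ∈-allValues⁻ : ∀ n {v} → v ∈ allValues n → ∃ λ s → ∃ λ t → 1 ℕ.≤ s × s ℕ.≤ t × t ℕ.≤ n × v ≡ M3nst n s t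
  ∈-allValues⁻ n v∈ with find (∈-concatMap⁻ (λ s → map (M3nst n s) (range s n)) v∈)
  ... | s , s∈ , v∈′ with ∈-map⁻ (M3nst n s) v∈′
  ... | t , t∈ , eq = s , t , proj₁ (∈-range⁻ 1 n s∈) , proj₁ (∈-range⁻ s n t∈) , proj₂ (∈-range⁻ s n t∈) , eq

  minList-≤ : ∀ d {x xs} → x ∈ xs → minList d xs ℕ.≤ x
  minList-≤ d {xs = y ∷ xs} (here refl) = ℕ.m⊓n≤m y (minList d xs)
  minList-≤ d {xs = y ∷ xs} (there x∈)  = ℕ.≤-trans (ℕ.m⊓n≤n y (minList d xs)) (minList-≤ d x∈)

  minList-elim : ∀ (P : ℕ → Set) d xs → P d → (∀ {x} → x ∈ xs → P x) → P (minList d xs)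
  minList-elim P d []       pd p = pd
  minList-elim P d (x ∷ xs) pd p with ℕ.⊓-sel x (minList d xs)
  ... | inj₁ eq = subst P (sym eq) (p (here refl))
  ... | inj₂ eq = subst P (sym eq) (minList-elim P d xs pd (λ x∈ → p (there x∈)))

  formula≤M3 : ∀ n → 1 ℕ.≤ n → formula n ≤ + M3 n
  formula≤M3 n 1≤n = minList-elim (λ v → formula n ≤ + v) (M3nst n 1 1) (allValues n)
    (formula≤M3nst n 1 1 ℕ.≤-refl ℕ.≤-refl 1≤n) bound
    where
    bound : ∀ {v} → v ∈ allValues n → formula n ≤ + v
    bound v∈ with ∈-allValues⁻ n v∈
    ... | s , t , 1≤s , s≤t , t≤n , refl = formula≤M3nst n s t 1≤s s≤t t≤n

  -- Realised by blocks of lengths `s`, `3s + c` and `r`; `r ≤ c` yields the condition `r ≤ 2t` of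
  -- `Blocks.upper`.
  M3≤cost : ∀ s r c → 1 ℕ.≤ s → r ℕ.≤ c → M3 (order s r c) ℕ.≤ cost s r c
  M3≤cost s r c 1≤s r≤c = subst (λ n → M3 n ℕ.≤ cost s r c) (n≡ s r c) (begin
    M3 (s ℕ.+ q ℕ.+ r)
      ≤⟨ minList-≤ _ (∈-allValues⁺ (s ℕ.+ q ℕ.+ r) s (s ℕ.+ q) 1≤s (ℕ.m≤m+n s q) (ℕ.m≤m+n (s ℕ.+ q) r)) ⟩
    M3nst (s ℕ.+ q ℕ.+ r) s (s ℕ.+ q)
      ≤⟨ Blocks.upper s q r (ℕ.m≤m+n (3 ℕ.* s) c) r≤2t ⟩
    τ s ℕ.+ τ (q ℕ.∸ 3 ℕ.* s) ℕ.+ τ r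
      ≡⟨ cong (λ x → τ s ℕ.+ τ x ℕ.+ τ r) (ℕ.m+n∸m≡n (3 ℕ.* s) c) ⟩
    τ s ℕ.+ τ c ℕ.+ τ r
      ≡⟨ swap (τ s) (τ c) (τ r) ⟩
    cost s r c ∎)
    where
    open ℕ.≤-Reasoning
    q = 3 ℕ.* s ℕ.+ c
    swap : ∀ a b c → a ℕ.+ b ℕ.+ c ≡ a ℕ.+ c ℕ.+ b
    swap = ℕ-Solver.solve-∀
    n≡ : ∀ s r c → s ℕ.+ (3 ℕ.* s ℕ.+ c) ℕ.+ r ≡ 4 ℕ.* s ℕ.+ r ℕ.+ c
    n≡ = ℕ-Solver.solve-∀
    r≤2t : r ℕ.≤ 2 ℕ.* (s ℕ.+ q)
    r≤2t = ℕ.≤-trans r≤c (ℕ.≤-trans (ℕ.m≤n+m c (3 ℕ.* s)) (ℕ.≤-trans (ℕ.m≤n+m q s) (ℕ.m≤n*m (s ℕ.+ q) 2)))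

  M3≤formula : ∀ n → Optimal n → + M3 n ≤ formula n
  M3≤formula n (s , r , c , 1≤s , r≤c , refl , le) = ℤ.≤-trans (+≤+ (M3≤cost s r c 1≤s r≤c)) le

open import Data.Nat using (ℕ; suc; _≤_; _%_; _≡ᵇ_)
open import Data.Integer using (+_; _+_; _-_; _*_; _/_; 0ℤ; 1ℤ; -1ℤ)
open import Data.Integer.Properties using (≤-antisym)

theorem3 : (n : ℕ) → 1 ≤ n →
    + M3 n ≡ ((+ n * + n - + 18 * + n + + 101) / + 108)
    + (if n % 54 ≡ᵇ 36 then 1ℤ else (if (n % 54 ≡ᵇ 30) ∨ (n % 54 ≡ᵇ 42) then -1ℤ else 0ℤ))
-- `Optimal` asks for `s ≥ 1`, hence for order at least 4; the smaller `n` are evaluated.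
theorem3 1 _ = refl
theorem3 2 _ = refl
theorem3 3 _ = refl
theorem3 n@(suc (suc (suc (suc m)))) 1≤n = ≤-antisym (M3≤formula n (optimal m)) (formula≤M3 n 1≤n)
  where open Optimisation
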